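{- There exist absolute constants $c>0$ and $k_0$ such that for every integer $k\ge k_0$, $\tau(T_k)\ge c\,k$, where $T_k$ is the complete binary tree of height $k$ (with $2^{k+1}-1$ vertices). That is, $\tau(T_k)=\Omega(k)$.
   Context: Graphs are simple. For a finite graph $G$ and $\theta:E(G)\to\mathbb{R}$, let $\Delta_\theta(F)=|V(F)|-\sum_{e\in E(F)}\theta(e)$ for subgraphs $F\subseteq G$ (subgraphs have no isolated vertices). A threshold weighting for $G$ is $\theta:E(G)\to[0,2]$ with $\Delta_\theta(F)\ge 0$ for all $F\subseteq G$ and $\Delta_\theta(G)=0$. For a vertex set $S$, $F\ominus S$ is the union of the connected components of $F$ that are vertex-disjoint from $S$. Join-trees: a join-tree over $G$ is a finite rooted binary tree (each non-leaf node has two ordered children) whose leaves are labeled by elements of $E(G)\cup\{\bot\}$; its graph $\langle A\rangle$ is the subgraph of $G$ whose edges are the edge labels occurring in $A$; $V(A)=V(\langle A\rangle)$. $[B,C]$ denotes the join-tree whose root has children $B,C$; one-node join-trees are atomic. Pathsets (fix $\theta$ and a positive integer $n$): for finite $U$, a relation is a subset of $[n]^U$, with density $\mu(\mathcal A)=|\mathcal A|/n^{|U|}$ ($[n]^\emptyset$ has one element). For $x\in[n]^V$, $x_U$ is its restriction to $U\subseteq V$. Join: for $\mathcal B\subseteq[n]^V,\mathcal C\subseteq[n]^W$, $\mathcal B\bowtie\mathcal C=\{z\in[n]^{V\cup W}: z_V\in\mathcal B,\ z_W\in\mathcal C\}$. Restriction: for $\mathcal A\subseteq[n]^V$ and $z\in[n]^T$,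 $\rho_{V\setminus T}(\mathcal A,z)=\{x\in[n]^{V\setminus T}:\exists y\in\mathcal A,\ y_{V\setminus T}=x,\ y_{V\cap T}=z_{V\cap T}\}$. For $F\subseteq G$ and $S\subseteq V(G)$, a relation $\mathcal A\subseteq[n]^{V(F)\setminus S}$ is an $F|S$-pathset if $\mu(\rho_{V(F)\setminus T}(\mathcal A,z))\le n^{ -\Delta_\theta(F\ominus T)}$ for all $T$ with $S\subseteq T\subseteq V(G)$ and all $z\in[n]^T$. Pathset complexity $\chi_{\theta,n,A|S}(\mathcal A)$ for $\mathcal A\subseteq[n]^{V(A)\setminus S}$: if $A$ is atomic, it is the minimum number $m$ of $\langle A\rangle|S$-pathsets whose union contains $\mathcal A$; if $A=[B,C]$, it is the minimum of $\sum_{i=1}^m\max\{\chi_{\theta,n,B|S}(\mathcal B_i),\chi_{\theta,n,C|S}(\mathcal C_i)\}$ over finite families $(\mathcal A_i,\mathcal B_i,\mathcal C_i)_{i\le m}$ where $\mathcal A_i,\mathcal B_i,\mathcal C_i$ are $\langle A\rangle|S$-, $\langle B\rangle|S$-, $\langle C\rangle|S$-pathsets respectively, $\mathcal A_i\subseteq\mathcal B_i\bowtie\mathcal C_i$, and $\mathcal A\subseteq\bigcup_i\mathcal A_i$. The invariant $\tau(G)$ of a finite graph $G$: the largest real $t\ge 0$ for which there is a threshold weighting $\theta$ for $G$ such that $\chi_{\theta,n,A|\emptyset}(\mathcal A)\ge n^{t}\mu(\mathcal A)$ for every join-tree $A$ over $G$ with $\langle A\rangle=G$, every positive integer $n$ and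 every $\mathcal A\subseteq[n]^{V(G)}$. -}

module Defs where

open import Data.Bool using (Bool; true; false; _∧_; _∨_; not; if_then_else_)
open import Data.Nat as ℕ using (ℕ; zero; suc; _⊔_; NonZero)
open import Data.Nat.Properties using (m^n≢0; ≤-trans; <⇒≤)
open import Data.Nat.DivMod using (_/_; m/n≤m)
open import Data.Integer using (ℤ; +_; -[1+_])
open import Data.Rational as ℚ using (ℚ; 0ℚ; 1ℚ; ↥_; ↧ₙ_)
open import Data.Fin using (Fin; toℕ; fromℕ<) renaming (_≟_ to _≟ᶠ_)
open import Data.Fin.Properties using (toℕ<n)
open import Data.Fin.Subset using (Subset; ⁅_⁆; _∪_; _∩_; _─_; _⊆_)
  renaming (⊥ to ∅; ⊤ to full)
open import Data.Vec using (Vec; []; _∷_; lookup; tabulate)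
open import Data.List using (List; []; _∷_; map; foldr; concatMap; length)
open import Data.Bool.ListAction using (any; all)
open import Data.List.Base using (allFin)
open import Data.List.Relation.Unary.All using (All)
open import Data.List.Relation.Unary.Any using (Any)
open import Data.Product using (Σ; _×_; _,_; proj₁)
open import Relation.Binary.PropositionalEquality using (_≡_)
open import Relation.Nullary using (does)

-- Graphs: vertex set Fin nV, edge set Fin nE, each edge e joins
-- src e and tgt e.  (Simplicity is not needed by the definitions; the
-- only graph used in the theorem, T k, is simple.)

record Graph : Set where
  field
    nV  : ℕ
    nE  : ℕ
    src : Fin nE → Fin nV
    tgt : Fin nE → Fin nV
open Graph public

-- Complete binary tree of height k, heap-indexed: vertices 0 .. 2^(k+1)-2,
-- edge j (0 ≤ j < 2^(k+1)-2) joins vertex j+1 to its parent ⌊j/2⌋.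
-- Number of vertices: suc (2^(k+1) ∸ 2) = 2^(k+1) - 1.
T : ℕ → Graph
T k = record
  { nV  = suc m
  ; nE  = m
  ; src = λ j → Data.Fin.suc j
  ; tgt = λ j → fromℕ< {toℕ j / 2}
                  (ℕ.s≤s (≤-trans (m/n≤m (toℕ j) 2) (<⇒≤ (toℕ<n j))))
  }
  where m = 2 ℕ.^ suc k ℕ.∸ 2

powℚ : ℚ → ℕ → ℚ
powℚ x zero    = 1ℚ
powℚ x (suc k) = x ℚ.* powℚ x k

ℕtoℚ : ℕ → ℚ
ℕtoℚ k = + k ℚ./ 1

-- PowMulLe n e x y  means   n^e · x ≤ y   (for n ≥ 1, x, y ≥ 0, e ∈ ℚ).
-- Writing e = p/q in lowest terms (q > 0) this is (n^e x)^q ≤ y^q, i.e.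
--   n^p x^q ≤ y^q            if p ≥ 0,
--   x^q ≤ n^(-p) y^q         if p < 0.
powMulLeAux : ℕ → ℤ → ℕ → ℚ → ℚ → Set
powMulLeAux n (+ a)      q x y = ℕtoℚ (n ℕ.^ a) ℚ.* powℚ x q ℚ.≤ powℚ y q
powMulLeAux n (-[1+ a ]) q x y = powℚ x q ℚ.≤ ℕtoℚ (n ℕ.^ suc a) ℚ.* powℚ y q

PowMulLe : ℕ → ℚ → ℚ → ℚ → Set
PowMulLe n e x y = powMulLeAux n (↥ e) (↧ₙ e) x y

-- Subgraphs (given by edge sets; subgraphs have no isolated vertices)

_∈ᵇ_ : ∀ {m} → Fin m → Subset m → Bool
i ∈ᵇ P = lookup P i

eqᵇ : ∀ {m} → Fin m → Fin m → Bool
eqᵇ i j = does (i ≟ᶠ j)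

card : ∀ {m} → Subset m → ℕ
card {m} P = foldr (λ i acc → if i ∈ᵇ P then suc acc else acc) 0 (allFin m)

module _ (G : Graph) where

  Vtx : Subset (nE G) → Subset (nV G)
  Vtx F = tabulate λ v →
    any (λ e → (e ∈ᵇ F) ∧ (eqᵇ (src G e) v ∨ eqᵇ (tgt G e) v)) (allFin (nE G))

  sumθ : (Fin (nE G) → ℚ) → Subset (nE G) → ℚ
  sumθ θ F = foldr (λ e acc → if e ∈ᵇ F then θ e ℚ.+ acc else acc) 0ℚ
                   (allFin (nE G))

  Δ : (Fin (nE G) → ℚ) → Subset (nE G) → ℚ
  Δ θ F = ℕtoℚ (card (Vtx F)) ℚ.- sumθ θ F

  ΔG : (Fin (nE G) → ℚ) → ℚ
  ΔG θ = ℕtoℚ (nV G) ℚ.- sumθ θ full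

  grow : Subset (nE G) → Subset (nV G) → Subset (nV G)
  grow F S = S ∪ tabulate λ v → any (λ e → (e ∈ᵇ F) ∧
               (((src G e ∈ᵇ S) ∧ eqᵇ (tgt G e) v) ∨
                ((tgt G e ∈ᵇ S) ∧ eqᵇ (src G e) v))) (allFin (nE G))

  iter : ℕ → (Subset (nV G) → Subset (nV G)) → Subset (nV G) → Subset (nV G)
  iter zero    f S = S
  iter (suc k) f S = f (iter k f S)

  reach : Subset (nE G) → Subset (nV G) → Subset (nV G)
  reach F S = iter (nV G) (grow F) S

  -- F ⊖ S : union of the components of F vertex-disjoint from S
  _⊖_ : Subset (nE G) → Subset (nV G) → Subset (nE G)
  F ⊖ S = tabulate λ e → (e ∈ᵇ F) ∧ not (src G e ∈ᵇ reach F S)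
                                   ∧ not (tgt G e ∈ᵇ reach F S)

  ThresholdWeighting : (Fin (nE G) → ℚ) → Set
  ThresholdWeighting θ =
    (∀ e → (0ℚ ℚ.≤ θ e) × (θ e ℚ.≤ ℕtoℚ 2)) ×
    (∀ (F : Subset (nE G)) → 0ℚ ℚ.≤ Δ θ F) ×
    (ΔG θ ≡ 0ℚ)

data Label (m : ℕ) : Set where
  edge : Fin m → Label m
  bot  : Label m

data JoinTree (G : Graph) : Set where
  leaf : Label (nE G) → JoinTree G
  node : JoinTree G → JoinTree G → JoinTree G

⟨_⟩ : ∀ {G} → JoinTree G → Subset (nE G)
⟨ leaf (edge e) ⟩ = ⁅ e ⁆
⟨ leaf bot ⟩      = ∅
⟨ node B C ⟩      = ⟨ B ⟩ ∪ ⟨ C ⟩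

VA : ∀ {G} → JoinTree G → Subset (nV G)
VA {G} A = Vtx G ⟨ A ⟩

-- Relations and pathsets (θ and n ≥ 1 fixed).
--
-- Encoding: a relation 𝒜 ⊆ [n]^U (U ⊆ V(G)) is represented by its
-- cylinder {x ∈ [n]^V(G) : x_U ∈ 𝒜}, i.e. a Boolean predicate on total
-- assignments which only depends on the coordinates in U.  This is a
-- bijective encoding; the density μ(𝒜) = |𝒜|/n^|U| equals the density
-- of the cylinder in [n]^V(G).

module Pathsets (G : Graph) (θ : Fin (nE G) → ℚ) (n : ℕ) .{{_ : NonZero n}} where

  N = nV G

  Assign : Set
  Assign = Vec (Fin n) N

  allVecs : (k : ℕ) → List (Vec (Fin n) k)
  allVecs zero    = [] ∷ []
  allVecs (suc k) = concatMap (λ i → map (i ∷_) (allVecs k)) (allFin n)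

  allAssign : List Assign
  allAssign = allVecs N

  agree : Subset N → Assign → Assign → Bool
  agree U x y = all (λ v → not (v ∈ᵇ U) ∨ eqᵇ (lookup x v) (lookup y v)) (allFin N)

  Determined : Subset N → (Assign → Bool) → Set
  Determined U P = ∀ x y → agree U x y ≡ true → P x ≡ P y

  Rel : Subset N → Set
  Rel U = Σ (Assign → Bool) (Determined U)

  count : (Assign → Bool) → ℕ
  count P = foldr (λ x acc → if P x then suc acc else acc) 0 allAssign

  μ : (Assign → Bool) → ℚ
  μ P = (+ count P) ℚ./ (n ℕ.^ N) where instance _ = m^n≢0 n N

  -- ρ_{V∖T}(𝒜, z) for 𝒜 ⊆ [n]^V, z ∈ [n]^T (z given as a total assignment)
  restrict : Subset N → Subset N → (Assign → Bool) → Assign → (Assign → Bool)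
  restrict V T P z w =
    any (λ y → P y ∧ agree (V ─ T) y w ∧ agree (V ∩ T) y z) allAssign

  Pathset : (F : Subset (nE G)) (S : Subset N) → Rel (Vtx G F ─ S) → Set
  Pathset F S 𝒜 =
    ∀ (T : Subset N) → S ⊆ T → (z : Assign) →
      PowMulLe n (Δ G θ (_⊖_ G F T)) (μ (restrict (Vtx G F ─ S) T (proj₁ 𝒜) z)) 1ℚ

  _∈ʳ_ : Assign → (Assign → Bool) → Set
  x ∈ʳ P = P x ≡ true

  -- ChiLe A S 𝒜 m  :  χ_{θ,n,A|S}(𝒜) ≤ m
  ChiLe : (A : JoinTree G) (S : Subset N) → Rel (VA A ─ S) → ℕ → Set
  ChiLe (leaf l) S 𝒜 m =
    Σ (List (Rel (VA {G} (leaf l) ─ S))) λ fam →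
      (length fam ℕ.≤ m) ×
      All (Pathset (⟨_⟩ {G} (leaf l)) S) fam ×
      (∀ x → x ∈ʳ proj₁ 𝒜 → Any (λ 𝒜ᵢ → x ∈ʳ proj₁ 𝒜ᵢ) fam)
  ChiLe (node B C) S 𝒜 m =
    Σ (List (Σ (Rel (VA (node B C) ─ S)) λ 𝒜ᵢ →
             Σ (Rel (VA B ─ S)) λ ℬᵢ →
             Σ (Rel (VA C ─ S)) λ 𝒞ᵢ →
             Σ ℕ λ bᵢ → Σ ℕ λ cᵢ →
               Pathset ⟨ node B C ⟩ S 𝒜ᵢ ×
               Pathset ⟨ B ⟩ S ℬᵢ ×
               Pathset ⟨ C ⟩ S 𝒞ᵢ ×
               ChiLe B S ℬᵢ bᵢ ×
               ChiLe C S 𝒞ᵢ cᵢ ×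
               (∀ x → x ∈ʳ proj₁ 𝒜ᵢ → (x ∈ʳ proj₁ ℬᵢ) × (x ∈ʳ proj₁ 𝒞ᵢ)))) λ fam →
      (∀ x → x ∈ʳ proj₁ 𝒜 → Any (λ t → x ∈ʳ proj₁ (proj₁ t)) fam) ×
      (foldr (λ { (_ , _ , _ , b , c , _) acc → (b ⊔ c) ℕ.+ acc }) 0 fam ℕ.≤ m)

{-# OPTIONS --safe #-}

-- Let θ e be the sum of the two transition probabilities along e of simple
-- random walk on T k. Then Δ θ F = Σ P(v , e) over vertices v of F and edges
-- e ∋ v outside F, so Δ θ F ≥ δ F / 3, where δ F counts the edges outside F
-- that touch F.
--
-- If A ⊖ S contains a complete subtree of height h of T k, then the complexity
-- of A|S is at least n ^ (((h - 8) + 12 δ) / 108) times the density, where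
-- δ = δ (A ⊖ S). The proof is by induction on A; put s = δ + 1. If h ≤ 8 s, the
-- pathset bound n ^ (δ / 3) suffices. Otherwise let t be the subtree of height
-- h. Go down A to the last [B , C] that still contains a subtree of t rooted at
-- depth less than 3 s. Along the leftmost path of this subtree, each right
-- branch contained in neither B nor C is crossed by the boundary of both; the
-- first one contained in, say, B is a subtree at depth at most 3 s + δ (B ⊖ S).
-- If δ (B ⊖ S) ≥ 2 s, then the induction hypothesis for B is strong enough on
-- its own. If not, then some right branch t' off the leftmost path of t, at
-- depth at most 2 s, is disjoint from V(B), because B contains no subtree of t
-- at depth less than 3 s. Breaking t' in the same way yields E ≺ A, and either
-- E suffices or δ (E ⊖ S) < 2 s. In the latter case the path from t' down to the
-- subtree found in E is longer than the boundary of E allows, so an edge of it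
-- is missing from E; hence that subtree survives in E ⊖ (S ∪ V(B)). Combining
-- the induction hypotheses for B|S and E|S ∪ V(B) with the density bound for A
-- gives the claim.
module Submission where

open import Defs
open import Data.Bool using (Bool; true; false; _∧_; _∨_; not; if_then_else_)
open import Data.Bool.ListAction using (any; all)
open import Data.Empty using (⊥; ⊥-elim)
open import Data.Fin using (Fin; zero; suc; toℕ; fromℕ<)
open import Data.Fin.Subset using (Subset; _∪_; _∩_; _─_; _⊆_) renaming (⊥ to ∅; ⊤ to full)
open import Data.List using (List; []; _∷_; foldr; concatMap; length)
open import Data.List.Relation.Unary.Any using (Any; here; there)
open import Data.List.Relation.Unary.All using (All; []; _∷_)
open import Data.Nat using (ℕ; zero; suc; _≤_; NonZero; z≤n; s≤s)
open import Data.Product using (Σ; ∃; _×_; _,_; proj₁; proj₂)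
open import Data.Sum using (_⊎_; inj₁; inj₂)
open import Data.Vec using (Vec; []; _∷_; lookup; tabulate)
open import Function using (_∘_; id; case_of_)
open import Relation.Binary.PropositionalEquality
open import Relation.Nullary using (¬_; Dec; yes; no)

-- Inequalities between powers of natural numbers.

module Powers where
  open import Data.Nat using (_+_; _*_; _^_; ≢-nonZero⁻¹)
  open import Data.Nat.Properties
  open import Data.Nat.Tactic.RingSolver using (solve-∀)

  ^-distribʳ-* : ∀ m n o → (m * n) ^ o ≡ m ^ o * n ^ o
  ^-distribʳ-* m n zero = refl
  ^-distribʳ-* m n (suc o) rewrite ^-distribʳ-* m n o = swap m n (m ^ o) (n ^ o)
    where
    swap : ∀ a b c d → a * b * (c * d) ≡ a * c * (b * d)
    swap = solve-∀

  ^-cancelˡ-≤ : ∀ q .{{_ : NonZero q}} {m n} → m ^ q ≤ n ^ q → m ≤ n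
  ^-cancelˡ-≤ q {m} {n} mq≤nq with m ≤? n
  ... | yes m≤n = m≤n
  ... | no m≰n = ⊥-elim (<⇒≱ (^-monoˡ-< q (≰⇒> m≰n)) mq≤nq)

  -- Comparing x / y with x' / y': if x' y ≤ x y', then replacing x / y by the
  -- mediant (x + x') / (y + y') only lowers the ratio.
  private
    mediant : ∀ K q {x y x' y'} → .{{_ : NonZero q}} → .{{_ : NonZero K}} →
              x' * y ≤ x * y' → K * x ^ q ≤ y ^ q → K * x' ^ q ≤ y' ^ q →
              K * (x + x') ^ q ≤ (y + y') ^ q
    -- With `y = 0` there is no positive `y ^ q` to cancel, but then `p` forces `x = 0`, and `p'` is
    -- the claim.
    mediant K (suc q) {x} {zero} {x'} {y'} _ p p'
      with m*n≡0⇒m≡0∨n≡0 K (n≤0⇒n≡0 p)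
    ... | inj₁ K≡0 = ⊥-elim (≢-nonZero⁻¹ K K≡0)
    ... | inj₂ xq≡0 rewrite m^n≡0⇒m≡0 x (suc q) xq≡0 = p'
    mediant K q {x} {y@(suc _)} {x'} {y'} cross p _ =
      *-cancelʳ-≤ _ _ (y ^ q) {{m^n≢0 y q}} (begin
        K * (x + x') ^ q * y ^ q    ≡⟨ *-assoc K _ _ ⟩
        K * ((x + x') ^ q * y ^ q)  ≡⟨ cong (K *_) (^-distribʳ-* (x + x') y q) ⟨
        K * ((x + x') * y) ^ q      ≤⟨ *-monoʳ-≤ K (^-monoˡ-≤ q step) ⟩
        K * (x * (y + y')) ^ q      ≡⟨ cong (K *_) (^-distribʳ-* x (y + y') q) ⟩
        K * (x ^ q * (y + y') ^ q)  ≡⟨ *-assoc K _ _ ⟨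
        K * x ^ q * (y + y') ^ q    ≤⟨ *-monoˡ-≤ _ p ⟩
        y ^ q * (y + y') ^ q        ≡⟨ *-comm (y ^ q) _ ⟩
        (y + y') ^ q * y ^ q        ∎)
      where
      open ≤-Reasoning
      step : (x + x') * y ≤ x * (y + y')
      step = begin
        (x + x') * y    ≡⟨ *-distribʳ-+ y x x' ⟩
        x * y + x' * y  ≤⟨ +-monoʳ-≤ (x * y) cross ⟩
        x * y + x * y'  ≡⟨ *-distribˡ-+ x y y' ⟨
        x * (y + y')    ∎

  -- With real roots the condition reads K^(1/q) x ≤ y, which is linear and hence additive. This is
  -- how bounds with fractional exponents are added up over unions and fibres.
  superadditive : ∀ K q {x y x' y'} → .{{_ : NonZero q}} → .{{_ : NonZero K}} →
                  K * x ^ q ≤ y ^ q → K * x' ^ q ≤ y' ^ q →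
                  K * (x + x') ^ q ≤ (y + y') ^ q
  superadditive K q {x} {y} {x'} {y'} p p' with ≤-total (x' * y) (x * y')
  ... | inj₁ c = mediant K q c p p'
  ... | inj₂ c rewrite +-comm x x' | +-comm y y' = mediant K q c p' p

-- Finite sums of natural numbers.

module Sums where
  open import Data.Nat using (_+_; _*_; _^_)
  open import Data.Nat.Properties
  open import Algebra.Properties.Semiring.Sum +-*-semiring public
    using (sum; sum-cong-≗; ∑-distrib-+; ∑-comm; *-distribˡ-sum; *-distribʳ-sum)
  open Powers

  𝟙 : Bool → ℕ
  𝟙 b = if b then 1 else 0

  sum-const : ∀ n c → sum {n} (λ _ → c) ≡ n * c
  sum-const zero    c = refl
  sum-const (suc n) c = cong (c +_) (sum-const n c)

  sum-mono : ∀ {n} {f g : Fin n → ℕ} → (∀ i → f i ≤ g i) → sum f ≤ sum g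
  sum-mono {zero}  p = z≤n
  sum-mono {suc n} p = +-mono-≤ (p zero) (sum-mono (p ∘ suc))

  sum-superadditive : ∀ K q {n} {f g : Fin n → ℕ} → .{{_ : NonZero q}} → .{{_ : NonZero K}} →
                      (∀ i → K * f i ^ q ≤ g i ^ q) → K * sum f ^ q ≤ sum g ^ q
  sum-superadditive K (suc q) {zero}  p = ≤-reflexive (*-zeroʳ K)
  sum-superadditive K q       {suc n} p =
    superadditive K q (p zero) (sum-superadditive K q (p ∘ suc))

  foldr-if-sum : ∀ {n} {A : Set} (p : A → Bool) (f : Fin n → A) →
                 foldr (λ x acc → if p x then suc acc else acc) 0 (Data.List.tabulate f)
                 ≡ sum (𝟙 ∘ p ∘ f)
  foldr-if-sum {zero}  p f = refl
  foldr-if-sum {suc n} p f with p (f zero)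
  ... | true  = cong suc (foldr-if-sum p (f ∘ suc))
  ... | false = foldr-if-sum p (f ∘ suc)

  card≡sum : ∀ {m} (F : Subset m) → card F ≡ sum (λ i → 𝟙 (i ∈ᵇ F))
  card≡sum F = foldr-if-sum (_∈ᵇ F) id

-- Counting and conditioning over assignments.

module Assignments (n : ℕ) where
  open import Data.Nat using (_+_; _*_; _^_)
  open import Data.Nat.Properties
  open import Data.List using (_++_; map)
  open Powers
  open Sums

  -- Summing coordinate by coordinate, instead of over the list of all vectors, lets facts about
  -- `sum` lift by induction on `k`.
  total : ∀ k → (Vec (Fin n) k → ℕ) → ℕ
  total zero    f = f []
  total (suc k) f = sum λ i → total k (f ∘ (i ∷_))

  total-cong : ∀ k {f g : Vec (Fin n) k → ℕ} → (∀ x → f x ≡ g x) → total k f ≡ total k g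
  total-cong zero    p = p []
  total-cong (suc k) p = sum-cong-≗ λ i → total-cong k (p ∘ (i ∷_))

  total-mono : ∀ k {f g : Vec (Fin n) k → ℕ} → (∀ x → f x ≤ g x) → total k f ≤ total k g
  total-mono zero    p = p []
  total-mono (suc k) p = sum-mono λ i → total-mono k (p ∘ (i ∷_))

  total-superadditive : ∀ K q → .{{_ : NonZero q}} → .{{_ : NonZero K}} →
                        ∀ k {f g : Vec (Fin n) k → ℕ} →
                        (∀ x → K * f x ^ q ≤ g x ^ q) → K * total k f ^ q ≤ total k g ^ q
  total-superadditive K q zero    p = p []
  total-superadditive K q (suc k) p =
    sum-superadditive K q λ i → total-superadditive K q k (p ∘ (i ∷_))

  total-+ : ∀ k (f g : Vec (Fin n) k → ℕ) → total k (λ x → f x + g x) ≡ total k f + total k g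
  total-+ zero    f g = refl
  total-+ (suc k) f g =
    trans (sum-cong-≗ λ i → total-+ k (f ∘ (i ∷_)) (g ∘ (i ∷_))) (∑-distrib-+ {n} _ _)

  total-*ʳ : ∀ k (f : Vec (Fin n) k → ℕ) c → total k (λ x → f x * c) ≡ total k f * c
  total-*ʳ zero    f c = refl
  total-*ʳ (suc k) f c =
    trans (sum-cong-≗ λ i → total-*ʳ k (f ∘ (i ∷_)) c) (sym (*-distribʳ-sum {n} c _))

  total-const : ∀ k c → total k (λ _ → c) ≡ n ^ k * c
  total-const zero    c = sym (*-identityˡ c)
  total-const (suc k) c =
    trans (sum-cong-≗ {n} λ _ → total-const k c)
          (trans (sum-const n _) (sym (*-assoc n _ c)))

  total-sum : ∀ k {m} (f : Vec (Fin n) k → Fin m → ℕ) →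
              total k (λ x → sum (f x)) ≡ sum (λ j → total k (λ x → f x j))
  total-sum zero    f = refl
  total-sum (suc k) {m} f =
    trans (sum-cong-≗ λ i → total-sum k {m} (f ∘ (i ∷_))) (∑-comm {n} {m} _)

  -- In the cylinder encoding, `P ∘ mix T z` is the restriction of `P` that fixes the coordinates in
  -- `T` to those of `z`.
  mix : ∀ {k} → Subset k → Vec (Fin n) k → Vec (Fin n) k → Vec (Fin n) k
  mix []      []      []      = []
  mix (t ∷ T) (a ∷ z) (b ∷ w) = (if t then a else b) ∷ mix T z w

  lookup-mix : ∀ {k} (T : Subset k) z w v →
               lookup (mix T z w) v ≡ (if v ∈ᵇ T then lookup z v else lookup w v)
  lookup-mix (t ∷ T) (a ∷ z) (b ∷ w) zero    = refl
  lookup-mix (t ∷ T) (a ∷ z) (b ∷ w) (suc v) = lookup-mix T z w v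

  -- Two successive restrictions, first to `S` and then to the larger `T`, amount to one restriction
  -- to `T`; on `S` the values of `y` prevail.
  mix-mix : ∀ {k} (S T : Subset k) → (∀ v → v ∈ᵇ S ≡ true → v ∈ᵇ T ≡ true) → ∀ y z w →
            mix S y (mix T z w) ≡ mix T (mix S y z) w
  mix-mix []          []      S⊆T []      []      []      = refl
  mix-mix (false ∷ S) (t ∷ T) S⊆T (_ ∷ y) (_ ∷ z) (_ ∷ w) = cong (_ ∷_) (mix-mix S T (S⊆T ∘ suc) y z w)
  mix-mix (true ∷ S)  (t ∷ T) S⊆T (a ∷ y) (_ ∷ z) (b ∷ w) with t | S⊆T zero refl
  ... | true | _ = cong (a ∷_) (mix-mix S T (S⊆T ∘ suc) y z w)

  -- A uniform z on T together with a uniform w off T is uniform.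
  total-mix : ∀ k (T : Subset k) f →
              total k (λ z → total k (λ w → f (mix T z w))) ≡ n ^ k * total k f
  total-mix zero    []      f = sym (*-identityˡ (f []))
  total-mix (suc k) (t ∷ T) f = begin
    sum (λ a → total k λ z → sum λ b → total k λ w → f (choose t a b ∷ mix T z w))
      ≡⟨ sum-cong-≗ {n} (λ a → total-sum k {n} _) ⟩
    sum (λ a → sum λ b → total k λ z → total k λ w → f (choose t a b ∷ mix T z w))
      ≡⟨ sum-cong-≗ {n} (λ a → sum-cong-≗ {n} λ b → total-mix k T (f ∘ (choose t a b ∷_))) ⟩
    sum (λ a → sum λ b → n ^ k * g (choose t a b))
      ≡⟨ uniform t ⟩
    n * (n ^ k * sum g)
      ≡⟨ *-assoc n (n ^ k) (sum g) ⟨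
    n ^ suc k * sum g ∎
    where
    open ≡-Reasoning
    choose : Bool → Fin n → Fin n → Fin n
    choose t a b = if t then a else b
    g : Fin n → ℕ
    g i = total k (f ∘ (i ∷_))
    uniform : ∀ t → sum (λ a → sum λ b → n ^ k * g (choose t a b)) ≡ n * (n ^ k * sum g)
    uniform false = trans (sum-const n _) (cong (n *_) (sym (*-distribˡ-sum {n} (n ^ k) g)))
    uniform true  = begin
      sum (λ a → sum {n} λ b → n ^ k * g a)  ≡⟨ sum-cong-≗ {n} (λ a → sum-const n _) ⟩
      sum (λ a → n * (n ^ k * g a))          ≡⟨ *-distribˡ-sum {n} n _ ⟨
      n * sum (λ a → n ^ k * g a)            ≡⟨ cong (n *_) (*-distribˡ-sum {n} (n ^ k) g) ⟨
      n * (n ^ k * sum g)                    ∎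

  ∣_∣ : ∀ {k} → (Vec (Fin n) k → Bool) → ℕ
  ∣_∣ {k} P = total k (𝟙 ∘ P)

  ∣∣-mono : ∀ {k} {P P' : Vec (Fin n) k → Bool} →
            (∀ x → P x ≡ true → P' x ≡ true) → ∣ P ∣ ≤ ∣ P' ∣
  ∣∣-mono {k} {P} {P'} P⊆P' = total-mono k λ x → lem (P x) (P' x) (P⊆P' x)
    where
    lem : ∀ b b' → (b ≡ true → b' ≡ true) → 𝟙 b ≤ 𝟙 b'
    lem false b' p = z≤n
    lem true  b' p rewrite p refl = ≤-refl

  ∣∣-∨ : ∀ {k} (P P' : Vec (Fin n) k → Bool) → ∣ (λ x → P x ∨ P' x) ∣ ≤ ∣ P ∣ + ∣ P' ∣
  ∣∣-∨ {k} P P' = ≤-trans (total-mono k λ x → lem (P x) (P' x)) (≤-reflexive (total-+ k _ _))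
    where
    lem : ∀ b b' → 𝟙 (b ∨ b') ≤ 𝟙 b + 𝟙 b'
    lem false b' = ≤-refl
    lem true  b' = s≤s z≤n

  ∣∣-∅ : ∀ {k} {P : Vec (Fin n) k → Bool} → (∀ x → P x ≡ false) → ∣ P ∣ ≡ 0
  ∣∣-∅ {k} p = trans (total-cong k (cong 𝟙 ∘ p)) (trans (total-const k 0) (*-zeroʳ (n ^ k)))

  -- Conditioning on the coordinates in T: if P only depends on T, then P ∧ P'
  -- is at most as dense as P times the largest density of P' over a fibre.
  ∣∣-∧-mix : ∀ K q → .{{_ : NonZero q}} → .{{_ : NonZero K}} → ∀ {k} (T : Subset k)
             {P P' : Vec (Fin n) k → Bool} {M} →
             (∀ z w → P (mix T z w) ≡ P z) →
             (∀ z → K * ∣ P' ∘ mix T z ∣ ^ q ≤ M ^ q) →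
             K * (n ^ k * ∣ (λ x → P x ∧ P' x) ∣) ^ q ≤ (∣ P ∣ * M) ^ q
  ∣∣-∧-mix K q@(suc _) {k} T {P} {P'} {M} det bound = begin
    K * (n ^ k * ∣ (λ x → P x ∧ P' x) ∣) ^ q
      ≡⟨ cong (λ m → K * m ^ q) (total-mix k T _) ⟨
    K * total k (λ z → total k λ w → 𝟙 (P (mix T z w) ∧ P' (mix T z w))) ^ q
      ≤⟨ total-superadditive K q k fibre ⟩
    total k (λ z → 𝟙 (P z) * M) ^ q
      ≡⟨ cong (_^ q) (total-*ʳ k _ M) ⟩
    (∣ P ∣ * M) ^ q ∎
    where
    open ≤-Reasoning
    fibre : ∀ z → K * total k (λ w → 𝟙 (P (mix T z w) ∧ P' (mix T z w))) ^ q
                  ≤ (𝟙 (P z) * M) ^ q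
    fibre z rewrite total-cong k (λ w → cong (λ b → 𝟙 (b ∧ P' (mix T z w))) (det z w)) with P z
    ... | true  rewrite *-identityˡ M = bound z
    ... | false rewrite total-const k 0 | *-zeroʳ (n ^ k) = ≤-reflexive (*-zeroʳ K)

  filterCount : ∀ {A : Set} → (A → Bool) → List A → ℕ
  filterCount P = foldr (λ x acc → if P x then suc acc else acc) 0

  filterCount-++ : ∀ {A : Set} (P : A → Bool) xs ys →
                   filterCount P (xs ++ ys) ≡ filterCount P xs + filterCount P ys
  filterCount-++ P []       ys = refl
  filterCount-++ P (x ∷ xs) ys with P x
  ... | true  = cong suc (filterCount-++ P xs ys)
  ... | false = filterCount-++ P xs ys

  filterCount-map : ∀ {A B : Set} (P : B → Bool) (f : A → B) xs →
                    filterCount P (map f xs) ≡ filterCount (P ∘ f) xs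
  filterCount-map P f []       = refl
  filterCount-map P f (x ∷ xs) with P (f x)
  ... | true  = cong suc (filterCount-map P f xs)
  ... | false = filterCount-map P f xs

  filterCount-concatMap : ∀ {m} {A B : Set} (P : B → Bool) (f : A → List B) (g : Fin m → A) →
                          filterCount P (concatMap f (Data.List.tabulate g))
                          ≡ sum (λ i → filterCount P (f (g i)))
  filterCount-concatMap {zero}  P f g = refl
  filterCount-concatMap {suc m} P f g =
    trans (filterCount-++ P (f (g zero)) _)
          (cong (filterCount P (f (g zero)) +_) (filterCount-concatMap P f (g ∘ suc)))

-- Vertex sets, components and boundaries of subgraphs.

module Subgraphs (G : Graph) where
  open import Data.Nat using (_<_)
  open import Data.Nat.Properties using (≤-trans; ≤-refl; ≤-antisym)
  open import Data.Bool.Properties using (T-≡)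
  open import Data.Fin.Properties using (¬∀⟶∃¬; _≟_)
  open import Data.Fin.Subset using (_∈_; _∉_; ∣_∣)
  open import Data.Fin.Subset.Properties
  open import Data.List using (allFin)
  open import Data.List.Membership.Propositional using (find; lose)
  open import Data.List.Membership.Propositional.Properties using (∈-allFin)
  open import Data.List.Relation.Unary.Any.Properties using (any⁺; any⁻)
  open import Data.Vec.Properties using (lookup∘tabulate; []=⇒lookup; lookup⇒[]=)
  open import Function.Bundles using (Equivalence)
  open import Relation.Nullary.Decidable using (dec-true; _→-dec_)
  open Equivalence

  Edge = Fin (nE G)
  Vertex = Fin (nV G)

  any-allFin⁺ : ∀ {m} (p : Fin m → Bool) i → p i ≡ true → any p (allFin m) ≡ true
  any-allFin⁺ p i eq = T-≡ .to (any⁺ p (lose (∈-allFin i) (T-≡ .from eq)))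

  any-allFin⁻ : ∀ {m} (p : Fin m → Bool) → any p (allFin m) ≡ true → ∃ λ i → p i ≡ true
  any-allFin⁻ p h = let i , _ , q = find (any⁻ p (allFin _) (T-≡ .from h)) in i , T-≡ .to q

  ∈-tabulate⁺ : ∀ {m} {p : Fin m → Bool} {i} → p i ≡ true → i ∈ tabulate p
  ∈-tabulate⁺ {p = p} {i} h = lookup⇒[]= i _ (trans (lookup∘tabulate p i) h)

  ∈-tabulate⁻ : ∀ {m} {p : Fin m → Bool} {i} → i ∈ tabulate p → p i ≡ true
  ∈-tabulate⁻ {p = p} {i} h = trans (sym (lookup∘tabulate p i)) ([]=⇒lookup h)

  ∧⁺ : ∀ {a b} → a ≡ true → b ≡ true → a ∧ b ≡ true
  ∧⁺ refl refl = refl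

  ∧⁻ : ∀ a {b} → a ∧ b ≡ true → a ≡ true × b ≡ true
  ∧⁻ true eq = refl , eq

  ∨⁺ : ∀ {a b} → a ≡ true ⊎ b ≡ true → a ∨ b ≡ true
  ∨⁺ {true}  _         = refl
  ∨⁺ {false} (inj₂ eq) = eq

  ∨⁻ : ∀ a {b} → a ∨ b ≡ true → a ≡ true ⊎ b ≡ true
  ∨⁻ true  eq = inj₁ refl
  ∨⁻ false eq = inj₂ eq

  not-∈⁺ : ∀ {m} {i : Fin m} {P : Subset m} → i ∉ P → not (i ∈ᵇ P) ≡ true
  not-∈⁺ {i = i} {P} i∉P with lookup P i in eq
  ... | true  = ⊥-elim (i∉P (lookup⇒[]= i P eq))
  ... | false = refl

  not-∈⁻ : ∀ {m} {i : Fin m} {P : Subset m} → not (i ∈ᵇ P) ≡ true → i ∉ P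
  not-∈⁻ {i = i} {P} eq i∈P rewrite []=⇒lookup i∈P = case eq of λ ()

  eqᵇ⁺ : ∀ {m} {i j : Fin m} → i ≡ j → eqᵇ i j ≡ true
  eqᵇ⁺ {i = i} {j} = dec-true (i ≟ j)

  eqᵇ⁻ : ∀ {m} {i j : Fin m} → eqᵇ i j ≡ true → i ≡ j
  eqᵇ⁻ {i = i} {j} eq with i ≟ j
  ... | yes i≡j = i≡j

  _∋_ : Edge → Vertex → Set
  e ∋ x = src G e ≡ x ⊎ tgt G e ≡ x

  ∈Vtx⁺ : ∀ {F e x} → e ∈ F → e ∋ x → x ∈ Vtx G F
  ∈Vtx⁺ {F} {e} {x} e∈F e∋x =
    ∈-tabulate⁺ (any-allFin⁺ _ e (∧⁺ ([]=⇒lookup e∈F) (∨⁺ (Data.Sum.map eqᵇ⁺ eqᵇ⁺ e∋x))))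

  ∈Vtx⁻ : ∀ {F x} → x ∈ Vtx G F → ∃ λ e → e ∈ F × e ∋ x
  ∈Vtx⁻ {F} {x} h =
    let e , q = any-allFin⁻ _ (∈-tabulate⁻ h)
        e∈F , q' = ∧⁻ (e ∈ᵇ F) q
    in e , lookup⇒[]= e F e∈F , Data.Sum.map eqᵇ⁻ eqᵇ⁻ (∨⁻ _ q')

  module _ (F : Subset (nE G)) where

    ⊆grow : ∀ S → S ⊆ grow G F S
    ⊆grow S = p⊆p∪q _

    grow⁺ : ∀ {S e x y} → e ∈ F → e ∋ x → e ∋ y → x ∈ S → y ∈ grow G F S
    grow⁺ {S} {e} {x} {y} e∈F ex ey x∈S = add ex ey
      where
      add : e ∋ x → e ∋ y → y ∈ grow G F S
      add (inj₁ refl) (inj₁ refl) = ⊆grow S x∈S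
      add (inj₂ refl) (inj₂ refl) = ⊆grow S x∈S
      add (inj₁ refl) (inj₂ refl) = q⊆p∪q S _ (∈-tabulate⁺ (any-allFin⁺ _ e
        (∧⁺ ([]=⇒lookup e∈F) (∨⁺ (inj₁ (∧⁺ ([]=⇒lookup x∈S) (eqᵇ⁺ {i = y} refl)))))))
      add (inj₂ refl) (inj₁ refl) = q⊆p∪q S _ (∈-tabulate⁺ (any-allFin⁺ _ e
        (∧⁺ ([]=⇒lookup e∈F) (∨⁺ (inj₂ (∧⁺ ([]=⇒lookup x∈S) (eqᵇ⁺ {i = y} refl)))))))

    grow⁻ : ∀ {S y} → y ∈ grow G F S →
            y ∈ S ⊎ ∃ λ e → e ∈ F × e ∋ y × ∃ λ x → e ∋ x × x ∈ S
    grow⁻ {S} {y} h with x∈p∪q⁻ S _ h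
    ... | inj₁ y∈S = inj₁ y∈S
    ... | inj₂ y∈ with any-allFin⁻ _ (∈-tabulate⁻ y∈)
    ...   | e , q with ∧⁻ (e ∈ᵇ F) q
    ...     | e∈F , q' with ∨⁻ _ q'
    ...       | inj₁ r = let s , t = ∧⁻ _ r in
                inj₂ (e , lookup⇒[]= e F e∈F , inj₂ (eqᵇ⁻ t) , _ , inj₁ refl , lookup⇒[]= _ S s)
    ...       | inj₂ r = let s , t = ∧⁻ _ r in
                inj₂ (e , lookup⇒[]= e F e∈F , inj₁ (eqᵇ⁻ t) , _ , inj₂ refl , lookup⇒[]= _ S s)

    private
      Closed : Subset (nV G) → Set
      Closed S = grow G F S ≡ S

      closed-or-larger : ∀ S → Closed S ⊎ ∣ S ∣ < ∣ grow G F S ∣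
      closed-or-larger S with grow G F S ⊆? S
      ... | yes sub = inj₁ (⊆-antisym sub (⊆grow S))
      ... | no ¬sub with ¬∀⟶∃¬ (nV G) (λ x → x ∈ grow G F S → x ∈ S)
                          (λ x → (x ∈? grow G F S) →-dec (x ∈? S)) (λ f → ¬sub (f _))
      ...   | x , ¬x = inj₂ (p⊂q⇒∣p∣<∣q∣ (⊆grow S , x , x∈ , λ x∈S → ¬x λ _ → x∈S))
        where
        x∈ : x ∈ grow G F S
        x∈ with x ∈? grow G F S
        ... | yes q = q
        ... | no  q = ⊥-elim (¬x (⊥-elim ∘ q))

      -- Every step before a fixed point adds a vertex, so `nV G` steps are enough: a set with that
      -- many elements is everything.
      closed-or-large : ∀ S k → Closed (iter G k (grow G F) S) ⊎ k ≤ ∣ iter G k (grow G F) S ∣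
      closed-or-large S zero    = inj₂ z≤n
      closed-or-large S (suc k) with closed-or-large S k
      ... | inj₁ cl = inj₁ (cong (grow G F) cl)
      ... | inj₂ k≤ with closed-or-larger (iter G k (grow G F) S)
      ...   | inj₁ cl = inj₁ (cong (grow G F) cl)
      ...   | inj₂ lt = inj₂ (≤-trans (s≤s k≤) lt)

      reach-closed : ∀ S → Closed (reach G F S)
      reach-closed S with closed-or-large S (nV G)
      ... | inj₁ cl = cl
      ... | inj₂ large = everything (∣p∣≡n⇒p≡⊤ (≤-antisym (∣p∣≤n (reach G F S)) large))
        where
        everything : ∀ {R} → R ≡ full → Closed R
        everything refl = ⊆-antisym (λ _ → ∈⊤) (⊆grow full)

      ⊆reach : ∀ S → S ⊆ reach G F S
      ⊆reach S = go (nV G)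
        where
        go : ∀ k → S ⊆ iter G k (grow G F) S
        go zero    x∈S = x∈S
        go (suc k) x∈S = ⊆grow _ (go k x∈S)

    module _ {S : Subset (nV G)} where

      ∈⊖⁺ : ∀ {e} → e ∈ F → (∀ x → e ∋ x → x ∉ reach G F S) → e ∈ _⊖_ G F S
      ∈⊖⁺ e∈F h = ∈-tabulate⁺ (∧⁺ ([]=⇒lookup e∈F)
        (∧⁺ (not-∈⁺ (h _ (inj₁ refl))) (not-∈⁺ (h _ (inj₂ refl)))))

      ∈⊖⁻ : ∀ {e} → e ∈ _⊖_ G F S → e ∈ F × (∀ x → e ∋ x → x ∉ reach G F S)
      ∈⊖⁻ {e} h =
        let e∈F , q = ∧⁻ (e ∈ᵇ F) (∈-tabulate⁻ h)
            q₁ , q₂ = ∧⁻ _ q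
        in lookup⇒[]= e F e∈F
           , λ { _ (inj₁ refl) → not-∈⁻ q₁ ; _ (inj₂ refl) → not-∈⁻ q₂ }

      ⊖⊆ : _⊖_ G F S ⊆ F
      ⊖⊆ = proj₁ ∘ ∈⊖⁻

      ⊖-avoids : ∀ {e x} → e ∈ _⊖_ G F S → e ∋ x → x ∉ S
      ⊖-avoids e∈ e∋x x∈S = proj₂ (∈⊖⁻ e∈) _ e∋x (⊆reach S x∈S)

      -- If an end of `f` were reached from `S`, one more step along `f` would reach `x`, an end of
      -- `e`.
      ⊖-closed : ∀ {e f x} → e ∈ _⊖_ G F S → e ∋ x → f ∈ F → f ∋ x → f ∈ _⊖_ G F S
      ⊖-closed {e} {f} {x} e∈ e∋x f∈F f∋x = ∈⊖⁺ f∈F λ y f∋y y∈ →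
        proj₂ (∈⊖⁻ e∈) x e∋x (subst (x ∈_) (reach-closed S) (grow⁺ f∈F f∋y f∋x y∈))

      -- By induction on the stage no vertex of `W` is ever reached: it would be entered along an
      -- edge of `F`, which by closedness is in `W` and has an end reached one stage earlier.
      ⊖-greatest : (W : Edge → Set) → (∀ {e} → W e → e ∈ F) →
                   (∀ {e f x} → W e → e ∋ x → f ∈ F → f ∋ x → W f) →
                   (∀ {e x} → W e → e ∋ x → x ∉ S) →
                   ∀ {e} → W e → e ∈ _⊖_ G F S
      ⊖-greatest W W⊆F closed avoids We = ∈⊖⁺ (W⊆F We) λ x e∋x → go (nV G) We e∋x
        where
        go : ∀ k {e x} → W e → e ∋ x → x ∉ iter G k (grow G F) S
        go zero    We e∋x x∈ = avoids We e∋x x∈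
        go (suc k) We e∋x x∈ with grow⁻ x∈
        ... | inj₁ x∈' = go k We e∋x x∈'
        ... | inj₂ (f , f∈F , f∋x , y , f∋y , y∈) = go k (closed We e∋x f∈F f∋x) f∋y y∈

  -- Passing from `A` to fewer edges only splits components, so what was separated from `S` stays
  -- separated.
  ⊖-restrict : ∀ {D A S e} → D ⊆ A → e ∈ D → e ∈ _⊖_ G A S → e ∈ _⊖_ G D S
  ⊖-restrict {D} {A} {S} D⊆A e∈D e∈A⊖S =
    ⊖-greatest D (λ e → e ∈ D × e ∈ _⊖_ G A S) proj₁
      (λ { (_ , e∈) e∋x f∈D f∋x → f∈D , ⊖-closed A e∈ e∋x (D⊆A f∈D) f∋x })
      (λ { (_ , e∈) → ⊖-avoids A e∈ })
      (e∈D , e∈A⊖S)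

  -- An edge of `D` at `x` lies in the same component of `A` as `e`, hence away from `S`. So along
  -- `A ⊖ S`, avoiding V(D ⊖ S) already means avoiding V(D).
  ∈Vtx-⊖ : ∀ {D A S e x} → D ⊆ A → e ∈ _⊖_ G A S → e ∋ x →
           x ∈ Vtx G D → x ∈ Vtx G (_⊖_ G D S)
  ∈Vtx-⊖ {D} {A} D⊆A e∈ e∋x x∈ =
    let f , f∈D , f∋x = ∈Vtx⁻ x∈
    in ∈Vtx⁺ (⊖-restrict D⊆A f∈D (⊖-closed A e∈ e∋x (D⊆A f∈D) f∋x)) f∋x

  boundary : Subset (nE G) → Edge → ℕ
  boundary F e = if e ∈ᵇ F then 0 else
    (if (src G e ∈ᵇ Vtx G F) ∨ (tgt G e ∈ᵇ Vtx G F) then 1 else 0)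

  boundary⁺ : ∀ {F e x} → e ∉ F → e ∋ x → x ∈ Vtx G F → 1 ≤ boundary F e
  boundary⁺ {F} {e} {x} e∉F e∋x x∈ with e ∈ᵇ F in eq
  ... | true  = ⊥-elim (e∉F (lookup⇒[]= e F eq))
  ... | false = touching (∨⁺ (ends e∋x))
    where
    ends : e ∋ x → (src G e ∈ᵇ Vtx G F) ≡ true ⊎ (tgt G e ∈ᵇ Vtx G F) ≡ true
    ends (inj₁ refl) = inj₁ ([]=⇒lookup x∈)
    ends (inj₂ refl) = inj₂ ([]=⇒lookup x∈)
    touching : ∀ {b} → b ≡ true → 1 ≤ (if b then 1 else 0)
    touching refl = ≤-refl

-- Subtrees of join-trees.

module JoinTrees (G : Graph) where
  open import Data.Fin.Subset.Properties using (p⊆p∪q; q⊆p∪q)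

  data _≼_ (D : JoinTree G) : JoinTree G → Set where
    here  : D ≼ D
    left  : ∀ {B C} → D ≼ B → D ≼ node B C
    right : ∀ {B C} → D ≼ C → D ≼ node B C

  data _≺_ (D : JoinTree G) : JoinTree G → Set where
    left  : ∀ {B C} → D ≼ B → D ≺ node B C
    right : ∀ {B C} → D ≼ C → D ≺ node B C

  ≺⇒≼ : ∀ {D A} → D ≺ A → D ≼ A
  ≺⇒≼ (left p)  = left p
  ≺⇒≼ (right p) = right p

  ≼-≺-trans : ∀ {D X A} → D ≺ X → X ≼ A → D ≺ A
  ≼-≺-trans p here      = p
  ≼-≺-trans p (left q)  = left (≺⇒≼ (≼-≺-trans p q))
  ≼-≺-trans p (right q) = right (≺⇒≼ (≼-≺-trans p q))

  ≼⇒⊆ : ∀ {D A} → D ≼ A → ⟨ D ⟩ ⊆ ⟨ A ⟩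
  ≼⇒⊆ here x = x
  ≼⇒⊆ {A = node B C} (left p)  x = p⊆p∪q ⟨ C ⟩ (≼⇒⊆ p x)
  ≼⇒⊆ {A = node B C} (right p) x = q⊆p∪q ⟨ B ⟩ ⟨ C ⟩ (≼⇒⊆ p x)

  -- The argument descends to subtrees of unknown depth, so the hypothesis has to cover all proper
  -- subtrees and not only the two children.
  ≺-induction : (P : JoinTree G → Set) → (∀ A → (∀ D → D ≺ A → P D) → P A) → ∀ A → P A
  ≺-induction P step A = step A (below A)
    where
    below  : ∀ A D → D ≺ A → P D
    below≼ : ∀ A D → D ≼ A → P D
    below (node B C) D (left p)  = below≼ B D p
    below (node B C) D (right p) = below≼ C D p
    below≼ A          .A here      = step A (below A)
    below≼ (node B C) D  (left p)  = below≼ B D p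
    below≼ (node B C) D  (right p) = below≼ C D p

-- Complete binary trees inside a graph.

module Trees (G : Graph) (src-injective : ∀ {e f} → src G e ≡ src G f → e ≡ f) where
  open import Data.Nat using (_+_; _<_)
  open import Data.Nat.Properties
  open import Data.Fin.Subset using (_∈_; _∉_)
  open import Data.Fin.Subset.Properties using (_∈?_)
  open Subgraphs G

  -- `src` is the child end of an edge and `tgt` the parent end. By `complete`, a subtree is joined
  -- to the rest of the graph only through the edge above its root.
  record Fork (v : Vertex) : Set where
    field
      eˡ eʳ    : Edge
      tgtˡ     : tgt G eˡ ≡ v
      tgtʳ     : tgt G eʳ ≡ v
      distinct : eˡ ≢ eʳ
      complete : ∀ e → tgt G e ≡ v → e ≡ eˡ ⊎ e ≡ eʳ
  open Fork public

  -- Complete binary trees whose vertices have no further children in G.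
  data Tree : ℕ → Vertex → Set where
    leaf : ∀ {v} → (∀ e → tgt G e ≢ v) → Tree 0 v
    node : ∀ {h v} (c : Fork v) → Tree h (src G (eˡ c)) → Tree h (src G (eʳ c)) → Tree (suc h) v

  private variable
    h h' g d d' : ℕ
    u v w : Vertex

  data _∈ᵥ_ (x : Vertex) : Tree h v → Set where
    root : {t : Tree h v} → x ≡ v → x ∈ᵥ t
    inˡ  : ∀ {c l r} → x ∈ᵥ l → x ∈ᵥ node {h} {v} c l r
    inʳ  : ∀ {c l r} → x ∈ᵥ r → x ∈ᵥ node {h} {v} c l r

  data _∈ₜ_ (e : Edge) : Tree h v → Set where
    edgeˡ : ∀ {c l r} → e ≡ eˡ c → e ∈ₜ node {h} {v} c l r
    edgeʳ : ∀ {c l r} → e ≡ eʳ c → e ∈ₜ node {h} {v} c l r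
    inˡ   : ∀ {c l r} → e ∈ₜ l → e ∈ₜ node {h} {v} c l r
    inʳ   : ∀ {c l r} → e ∈ₜ r → e ∈ₜ node {h} {v} c l r

  -- The first index is the depth of the smaller tree's root in the larger tree.
  data Sub : ℕ → Tree h v → Tree h' w → Set where
    here  : {t : Tree h v} → Sub 0 t t
    left  : ∀ {c l r} {s : Tree h v} → Sub d s l → Sub (suc d) s (node {h'} {w} c l r)
    right : ∀ {c l r} {s : Tree h v} → Sub d s r → Sub (suc d) s (node {h'} {w} c l r)

  Sub-trans : ∀ {h₁ h₂ h₃ v₁ v₂ v₃} {t₁ : Tree h₁ v₁} {t₂ : Tree h₂ v₂} {t₃ : Tree h₃ v₃} →
              Sub d t₁ t₂ → Sub d' t₂ t₃ → Sub (d' + d) t₁ t₃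
  Sub-trans p here      = p
  Sub-trans p (left q)  = left (Sub-trans p q)
  Sub-trans p (right q) = right (Sub-trans p q)

  Sub-height : {s : Tree h v} {t : Tree h' w} → Sub d s t → h' ≡ d + h
  Sub-height here      = refl
  Sub-height (left p)  = cong suc (Sub-height p)
  Sub-height (right p) = cong suc (Sub-height p)

  Sub-∈ₜ : ∀ {s : Tree h v} {t : Tree h' w} {e} → Sub d s t → e ∈ₜ s → e ∈ₜ t
  Sub-∈ₜ here      q = q
  Sub-∈ₜ (left p)  q = inˡ (Sub-∈ₜ p q)
  Sub-∈ₜ (right p) q = inʳ (Sub-∈ₜ p q)

  Sub-∈ᵥ : ∀ {s : Tree h v} {t : Tree h' w} {x} → Sub d s t → x ∈ᵥ s → x ∈ᵥ t
  Sub-∈ᵥ here      q = q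
  Sub-∈ᵥ (left p)  q = inˡ (Sub-∈ᵥ p q)
  Sub-∈ᵥ (right p) q = inʳ (Sub-∈ᵥ p q)

  ∈ₜ-ends : ∀ {t : Tree h v} {e x} → e ∈ₜ t → e ∋ x → x ∈ᵥ t
  ∈ₜ-ends (edgeˡ refl)         (inj₁ eq) = inˡ (root (sym eq))
  ∈ₜ-ends (edgeˡ {c = c} refl) (inj₂ eq) = root (trans (sym eq) (tgtˡ c))
  ∈ₜ-ends (edgeʳ refl)         (inj₁ eq) = inʳ (root (sym eq))
  ∈ₜ-ends (edgeʳ {c = c} refl) (inj₂ eq) = root (trans (sym eq) (tgtʳ c))
  ∈ₜ-ends (inˡ p) q = inˡ (∈ₜ-ends p q)
  ∈ₜ-ends (inʳ p) q = inʳ (∈ₜ-ends p q)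

  -- Downward edges are listed by the forks. An upward edge is determined by its lower end, so one
  -- that leaves a child's subtree is the fork edge to that child.
  incident : ∀ (t : Tree h v) {x e} → x ∈ᵥ t → e ∋ x → e ∈ₜ t ⊎ src G e ≡ v
  incident t            (root refl) (inj₁ eq) = inj₂ eq
  incident (leaf none)  (root refl) (inj₂ eq) = ⊥-elim (none _ eq)
  incident (node c l r) (root refl) (inj₂ eq) = inj₁ (Data.Sum.[ edgeˡ , edgeʳ ]′ (complete c _ eq))
  incident (node c l r) (inˡ p) q with incident l p q
  ... | inj₁ e∈ = inj₁ (inˡ e∈)
  ... | inj₂ eq = inj₁ (edgeˡ (src-injective eq))
  incident (node c l r) (inʳ p) q with incident r p q
  ... | inj₁ e∈ = inj₁ (inʳ e∈)
  ... | inj₂ eq = inj₁ (edgeʳ (src-injective eq))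

  sumₜ : Tree h v → (Edge → ℕ) → ℕ
  sumₜ (leaf _)     f = 0
  sumₜ (node c l r) f = (f (eˡ c) + sumₜ l f) + (f (eʳ c) + sumₜ r f)

  Sub-sumₜ : {s : Tree h v} {t : Tree h' w} → Sub d s t → ∀ f → sumₜ s f ≤ sumₜ t f
  Sub-sumₜ here f = ≤-refl
  Sub-sumₜ {t = node c l r} (left p) f =
    m≤n⇒m≤n+o (f (eʳ c) + sumₜ r f) (m≤n⇒m≤o+n (f (eˡ c)) (Sub-sumₜ p f))
  Sub-sumₜ {t = node c l r} (right p) f =
    m≤n⇒m≤o+n (f (eˡ c) + sumₜ l f) (m≤n⇒m≤o+n (f (eʳ c)) (Sub-sumₜ p f))

  _⊆ₜ_ : Tree h v → Subset (nE G) → Set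
  t ⊆ₜ F = ∀ {e} → e ∈ₜ t → e ∈ F

  _⊆ₜ?_ : ∀ (t : Tree h v) F → Dec (t ⊆ₜ F)
  leaf _     ⊆ₜ? F = yes λ ()
  node c l r ⊆ₜ? F with eˡ c ∈? F | eʳ c ∈? F | l ⊆ₜ? F | r ⊆ₜ? F
  ... | no ¬p | _     | _     | _     = no λ f → ¬p (f (edgeˡ refl))
  ... | _     | no ¬p | _     | _     = no λ f → ¬p (f (edgeʳ refl))
  ... | _     | _     | no ¬p | _     = no λ f → ¬p λ x → f (inˡ x)
  ... | _     | _     | _     | no ¬p = no λ f → ¬p λ x → f (inʳ x)
  ... | yes a | yes b | yes p | yes q =
    yes λ { (edgeˡ refl) → a ; (edgeʳ refl) → b ; (inˡ x) → p x ; (inʳ x) → q x }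

  -- A planted tree is a tree together with the edge above its root.
  _∈ₚ[_,_] : Edge → (e : Edge) → Tree h (src G e) → Set
  f ∈ₚ[ e , t ] = f ≡ e ⊎ f ∈ₜ t

  PlantedIn : (e : Edge) → Tree h (src G e) → Subset (nE G) → Set
  PlantedIn e t F = ∀ {f} → f ∈ₚ[ e , t ] → f ∈ F

  plantedIn? : ∀ e (t : Tree h (src G e)) F → Dec (PlantedIn e t F)
  plantedIn? e t F with e ∈? F | t ⊆ₜ? F
  ... | no ¬p | _     = no λ f → ¬p (f (inj₁ refl))
  ... | _     | no ¬p = no λ f → ¬p λ x → f (inj₂ x)
  ... | yes a | yes p = yes λ { (inj₁ refl) → a ; (inj₂ x) → p x }

  -- Connectedness of trees: a tree inside neither F nor its complement is
  -- crossed by the boundary of F.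
  module _ (F : Subset (nE G)) where

    -- For a single vertex `t ⊆ₜ F` is vacuous; the membership of the root in V(F) is what makes a
    -- missing edge above it a boundary edge.
    data Status (t : Tree h v) : Set where
      inside  : t ⊆ₜ F → v ∈ Vtx G F → Status t
      crossed : 1 ≤ sumₜ t (boundary F) → Status t
      outside : (∀ {x} → x ∈ᵥ t → x ∉ Vtx G F) → Status t

    data PlantedStatus (e : Edge) (t : Tree h (src G e)) : Set where
      inside  : PlantedIn e t F → PlantedStatus e t
      crossed : 1 ≤ boundary F e + sumₜ t (boundary F) → PlantedStatus e t
      outside : tgt G e ∉ Vtx G F → (∀ {x} → x ∈ᵥ t → x ∉ Vtx G F) → PlantedStatus e t

    plant : ∀ e {t : Tree h (src G e)} → Status t → PlantedStatus e t
    plant e (crossed b) = crossed (m≤n⇒m≤o+n (boundary F e) b)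
    plant e {t} (inside t⊆ v∈) with e ∈? F
    ... | yes e∈ = inside λ { (inj₁ refl) → e∈ ; (inj₂ x) → t⊆ x }
    ... | no e∉  = crossed (m≤n⇒m≤n+o _ (boundary⁺ e∉ (inj₁ refl) v∈))
    plant e {t} (outside t∩) with e ∈? F
    ... | yes e∈ = ⊥-elim (t∩ (root refl) (∈Vtx⁺ e∈ (inj₁ refl)))
    ... | no e∉ with tgt G e ∈? Vtx G F
    ...   | yes x∈ = crossed (m≤n⇒m≤n+o _ (boundary⁺ e∉ (inj₂ refl) x∈))
    ...   | no x∉  = outside x∉ t∩

    status : (t : Tree h v) → Status t
    status {v = v} (leaf _) with v ∈? Vtx G F
    ... | yes v∈ = inside (λ ()) v∈
    ... | no v∉  = outside λ { (root refl) → v∉ }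
    status (node c l r) with plant (eˡ c) (status l) | plant (eʳ c) (status r)
    ... | crossed b | _         = crossed (m≤n⇒m≤n+o _ b)
    ... | inside _  | crossed b = crossed (m≤n⇒m≤o+n (boundary F (eˡ c) + sumₜ l (boundary F)) b)
    ... | outside _ _ | crossed b = crossed (m≤n⇒m≤o+n (boundary F (eˡ c) + sumₜ l (boundary F)) b)
    ... | inside p  | inside q  =
      inside (λ { (edgeˡ refl) → p (inj₁ refl) ; (edgeʳ refl) → q (inj₁ refl)
                ; (inˡ x) → p (inj₂ x) ; (inʳ x) → q (inj₂ x) })
             (∈Vtx⁺ (p (inj₁ refl)) (inj₂ (tgtˡ c)))
    -- The two planted trees share the vertex `v`, which cannot be both in V(F) and outside it.
    ... | inside p  | outside x∉ _ =
      ⊥-elim (x∉ (∈Vtx⁺ (p (inj₁ refl)) (inj₂ (trans (tgtˡ c) (sym (tgtʳ c))))))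
    ... | outside x∉ _ | inside q =
      ⊥-elim (x∉ (∈Vtx⁺ (q (inj₁ refl)) (inj₂ (trans (tgtʳ c) (sym (tgtˡ c))))))
    ... | outside x∉ p | outside _ q =
      outside λ { (root refl) → λ z → x∉ (subst (_∈ Vtx G F) (sym (tgtˡ c)) z)
                ; (inˡ x) → p x ; (inʳ x) → q x }

    planted-status : ∀ e (t : Tree h (src G e)) → PlantedStatus e t
    planted-status e t = plant e (status t)

  -- `F` contains a subtree of `t` with root at depth strictly less than `g`. In this form it is
  -- decidable by recursion, and its negation passes to both children with `g` lowered by one.
  data Shallow (F : Subset (nE G)) : ℕ → Tree h v → Set where
    top : {t : Tree h v} → t ⊆ₜ F → Shallow F (suc g) t
    inˡ : ∀ {c l r} → Shallow F g l → Shallow F (suc g) (node {h} {v} c l r)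
    inʳ : ∀ {c l r} → Shallow F g r → Shallow F (suc g) (node {h} {v} c l r)

  shallow? : ∀ F g (t : Tree h v) → Dec (Shallow F g t)
  shallow? F zero    t = no λ ()
  shallow? F (suc g) t with t ⊆ₜ? F
  ... | yes p = yes (top p)
  shallow? F (suc g) t@(leaf _) | no ¬p = no λ { (top p) → ¬p p }
  shallow? F (suc g) (node c l r) | no ¬p with shallow? F g l | shallow? F g r
  ... | yes q | _     = yes (inˡ q)
  ... | no _  | yes q = yes (inʳ q)
  ... | no ¬q | no ¬q' = no λ { (top p) → ¬p p ; (inˡ q) → ¬q q ; (inʳ q) → ¬q' q }

  shallow⁻ : ∀ {F} {t : Tree h v} → Shallow F g t →
             ∃ λ d → ∃ λ h' → ∃ λ u → ∃ λ (s : Tree h' u) → Sub d s t × d < g × s ⊆ₜ F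
  shallow⁻ (top p) = 0 , _ , _ , _ , here , s≤s z≤n , p
  shallow⁻ (inˡ q) = let d , _ , _ , s , p , d< , s⊆ = shallow⁻ q in suc d , _ , _ , s , left p , s≤s d< , s⊆
  shallow⁻ (inʳ q) = let d , _ , _ , s , p , d< , s⊆ = shallow⁻ q in suc d , _ , _ , s , right p , s≤s d< , s⊆

-- Finding subtrees in the two sides of a join.

module Breaking (G : Graph) (src-injective : ∀ {e f} → src G e ≡ src G f → e ≡ f) where
  open import Data.Nat using (_+_; _<_; s≤s⁻¹)
  open import Data.Nat.Properties
  open import Data.Fin.Subset using (_∈_; _∉_)
  open import Data.Fin.Subset.Properties using (_∈?_; ∉⊥; x∈⁅y⁆⇒x≡y; p⊆p∪q; q⊆p∪q; x∈p∪q⁻)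
  open Subgraphs G
  open Trees G src-injective
  open JoinTrees G

  private variable
    h h' g d : ℕ
    u v : Vertex

  private
    ∂ : Subset (nE G) → Subset (nV G) → Edge → ℕ
    ∂ F S = boundary (_⊖_ G F S)

    positive-height : ∀ {t : Tree h v} {s : Tree h' u} → Sub d s t → d < g → g ≤ h → 0 < h'
    positive-height {h = h} {h' = h'} {d = d} p d<g g≤h =
      +-cancelˡ-< d 0 h' (<-≤-trans (≤-<-trans (≤-reflexive (+-identityʳ d)) (<-≤-trans d<g g≤h))
                                     (≤-reflexive (Sub-height p)))

  module _ (A : Subset (nE G)) (S : Subset (nV G)) where

    -- Otherwise the planted tree is inside D ⊖ S or disjoint from it. In the second case none of
    -- its edges is in `D`, because such an edge would survive in D ⊖ S; so all of them are in `D'`.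
    mixed : ∀ {D D'} → D ⊆ A → ∀ e (t : Tree h (src G e)) →
            PlantedIn e t (_⊖_ G A S) → (∀ {f} → f ∈ₚ[ e , t ] → f ∈ D ⊎ f ∈ D') →
            ¬ PlantedIn e t D → ¬ PlantedIn e t D' →
            1 ≤ ∂ D S e + sumₜ t (∂ D S)
    mixed {D = D} {D'} D⊆A e t t⊆ cover ¬D ¬D' with planted-status (_⊖_ G D S) e t
    ... | crossed b = b
    ... | inside p  = ⊥-elim (¬D λ x → ⊖⊆ D {S} (p x))
    ... | outside _ t∩ = ⊥-elim (¬D' other)
      where
      other : PlantedIn e t D'
      other x with cover x
      ... | inj₂ f∈D' = f∈D'
      ... | inj₁ f∈D  = ⊥-elim (t∩ (end x) (∈Vtx⁺ (⊖-restrict D⊆A f∈D (t⊆ x)) (inj₁ refl)))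
        where
        end : ∀ {f} → f ∈ₚ[ e , t ] → src G f ∈ᵥ t
        end (inj₁ refl) = root refl
        end (inj₂ x)    = ∈ₜ-ends x (inj₁ refl)

    -- Walk down the leftmost path of a tree covered by B ∪ C. Every right
    -- planted subtree passed contributes a boundary edge, until one lies in B
    -- or in C.
    walk : ∀ (s : Tree (suc h) v) {B C} → B ⊆ A → C ⊆ A →
           s ⊆ₜ _⊖_ G A S → (∀ {e} → e ∈ₜ s → e ∈ B ⊎ e ∈ C) →
           ∃ λ D → (D ≡ B ⊎ D ≡ C) × ∃ λ d → ∃ λ h' → ∃ λ u → ∃ λ (t : Tree h' u) →
             Sub d t s × t ⊆ₜ D × d ≤ suc (sumₜ s (∂ D S))
    -- The path is exhausted: a single vertex, contained in any edge set, ends the walk.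
    walk (node c (leaf _) r@(leaf _)) {B} {C} B⊆A C⊆A s⊆ cover with cover (edgeʳ refl)
    ... | inj₁ _ = B , inj₁ refl , 1 , _ , _ , r , right here , (λ ()) , s≤s z≤n
    ... | inj₂ _ = C , inj₂ refl , 1 , _ , _ , r , right here , (λ ()) , s≤s z≤n
    walk (node c l@(node _ _ _) r) {B} {C} B⊆A C⊆A s⊆ cover
      with plantedIn? (eʳ c) r B | plantedIn? (eʳ c) r C
    ... | yes p | _ = B , inj₁ refl , 1 , _ , _ , r , right here , (λ x → p (inj₂ x)) , s≤s z≤n
    ... | no _ | yes p = C , inj₂ refl , 1 , _ , _ , r , right here , (λ x → p (inj₂ x)) , s≤s z≤n
    ... | no ¬B | no ¬C with walk l B⊆A C⊆A (λ x → s⊆ (inˡ x)) (λ x → cover (inˡ x))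
    ...   | D , which , d , _ , _ , t , p , t⊆ , d≤ =
      D , which , suc d , _ , _ , t , left p , t⊆ , s≤s (≤-trans d≤ (deeper which))
      where
      planted : ∀ {f} → f ∈ₚ[ eʳ c , r ] → f ∈ₜ node c l r
      planted (inj₁ refl) = edgeʳ refl
      planted (inj₂ x)    = inʳ x
      crossing : D ≡ B ⊎ D ≡ C → 1 ≤ ∂ D S (eʳ c) + sumₜ r (∂ D S)
      crossing (inj₁ refl) = mixed B⊆A (eʳ c) r (λ x → s⊆ (planted x)) (λ x → cover (planted x)) ¬B ¬C
      crossing (inj₂ refl) = mixed C⊆A (eʳ c) r (λ x → s⊆ (planted x))
                                   (λ x → Data.Sum.swap (cover (planted x))) ¬C ¬B
      deeper : D ≡ B ⊎ D ≡ C → suc (sumₜ l (∂ D S)) ≤ sumₜ (node c l r) (∂ D S)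
      deeper w = ≤-trans (≤-reflexive (+-comm 1 _))
                         (+-mono-≤ (m≤n+m (sumₜ l (∂ D S)) (∂ D S (eˡ c))) (crossing w))

  -- Descend as long as one child still has a shallow subtree. The descent cannot end at a leaf:
  -- since `g ≤ h`, a shallow subtree has positive height and thus two distinct edges.
  split : ∀ A (t : Tree h v) → g ≤ h → Shallow ⟨ A ⟩ g t →
          ∃ λ B → ∃ λ C → node B C ≼ A × Shallow ⟨ node B C ⟩ g t ×
                          ¬ Shallow ⟨ B ⟩ g t × ¬ Shallow ⟨ C ⟩ g t
  split (leaf l) t g≤h sh with shallow⁻ sh
  ... | d , h' , u , s , p , d< , s⊆ = ⊥-elim (absurd l s (positive-height p d< g≤h) s⊆)
    where
    absurd : ∀ {h'} l (s : Tree h' u) → 0 < h' → s ⊆ₜ ⟨ leaf l ⟩ → ⊥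
    absurd (edge e) (node c _ _) _ s⊆ =
      distinct c (trans (x∈⁅y⁆⇒x≡y e (s⊆ (edgeˡ refl))) (sym (x∈⁅y⁆⇒x≡y e (s⊆ (edgeʳ refl)))))
    absurd bot (node c _ _) _ s⊆ = ∉⊥ (s⊆ (edgeˡ refl))
  split {g = g} (node B C) t g≤h sh with shallow? ⟨ B ⟩ g t | shallow? ⟨ C ⟩ g t
  ... | yes p | _ = let _ , _ , q , r = split B t g≤h p in _ , _ , left q , r
  ... | no _ | yes p = let _ , _ , q , r = split C t g≤h p in _ , _ , right q , r
  ... | no ¬p | no ¬q = B , C , here , sh , ¬p , ¬q

  -- `D` has lost all subtrees near the top of `t` but keeps one not far below; any depth beyond `g`
  -- is paid for by boundary edges of D ⊖ S within `t`.
  Break : JoinTree G → Subset (nV G) → Tree h v → ℕ → Set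
  Break A S t g =
    ∃ λ D → D ≺ A × ¬ Shallow ⟨ D ⟩ g t × ∃ λ d → ∃ λ h' → ∃ λ u → ∃ λ (s : Tree h' u) →
      Sub d s t × s ⊆ₜ ⟨ D ⟩ × d ≤ g + sumₜ t (∂ ⟨ D ⟩ S)

  break : ∀ A S (t : Tree h v) g → 0 < g → g ≤ h → t ⊆ₜ _⊖_ G ⟨ A ⟩ S → Break A S t g
  break A S t g@(suc _) 0<g g≤h t⊆ with split A t g≤h (top λ x → ⊖⊆ ⟨ A ⟩ {S} (t⊆ x))
  ... | B , C , BC≼A , sh , ¬B , ¬C with shallow⁻ sh
  ...   | d , zero , _ , _ , p , d< , _ = ⊥-elim (<-irrefl refl (positive-height p d< g≤h))
  ...   | d , suc _ , _ , s , p , d< , s⊆ with walk ⟨ A ⟩ S s {⟨ B ⟩} {⟨ C ⟩}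
            (λ x → ≼⇒⊆ BC≼A (p⊆p∪q ⟨ C ⟩ x)) (λ x → ≼⇒⊆ BC≼A (q⊆p∪q ⟨ B ⟩ ⟨ C ⟩ x))
            (λ x → t⊆ (Sub-∈ₜ p x)) (λ x → x∈p∪q⁻ ⟨ B ⟩ ⟨ C ⟩ (s⊆ x))
  ...     | F , which , d' , _ , _ , s' , p' , s'⊆ , d'≤ = conclude which
    where
    -- The strict `d < g` absorbs the `suc` in the depth bound of `walk`.
    depth : d + d' ≤ g + sumₜ t (∂ F S)
    depth = ≤-trans (+-monoʳ-≤ d d'≤) (≤-trans (≤-reflexive (+-suc d _))
              (+-mono-≤ d< (Sub-sumₜ p (∂ F S))))
    conclude : F ≡ ⟨ B ⟩ ⊎ F ≡ ⟨ C ⟩ → Break A S t g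
    conclude (inj₁ refl) =
      B , ≼-≺-trans (left here) BC≼A , ¬B , _ , _ , _ , s' , Sub-trans p' p , s'⊆ , depth
    conclude (inj₂ refl) =
      C , ≼-≺-trans (right here) BC≼A , ¬C , _ , _ , _ , s' , Sub-trans p' p , s'⊆ , depth

  -- Each right planted subtree hanging off the leftmost path is not inside B;
  -- so one of the first j of them avoids B if fewer than j edges bound B.
  avoiding : ∀ B S (t : Tree h v) j → j < g → g ≤ h → ¬ Shallow B g t → sumₜ t (∂ B S) < j →
             ∃ λ d → ∃ λ h' → ∃ λ u → ∃ λ (s : Tree h' u) → Sub d s t × d ≤ j ×
               (∀ {x} → x ∈ᵥ s → x ∉ Vtx G (_⊖_ G B S))
  avoiding {g = suc (suc g)} B S (node c l r) (suc j) j<g g≤h ¬sh sum<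
    with planted-status (_⊖_ G B S) (eʳ c) r
  ... | inside p = ⊥-elim (¬sh (inʳ (top λ x → ⊖⊆ B {S} (p (inj₂ x)))))
  ... | outside _ r∩ = 1 , _ , _ , r , right here , s≤s z≤n , r∩
  ... | crossed b with avoiding B S l j (s≤s⁻¹ j<g) (s≤s⁻¹ g≤h) (λ q → ¬sh (inˡ q))
                         (s≤s⁻¹ (≤-trans (s≤s (≤-trans (≤-reflexive (+-comm 1 _)) (+-mono-≤ (m≤n+m (sumₜ l (∂ B S)) (∂ B S (eˡ c))) b))) sum<))
  ...   | d , _ , _ , s , p , d≤ , s∩ = suc d , _ , _ , s , left p , s≤s d≤ , s∩
  avoiding {g = suc zero} B S t (suc j) (s≤s ()) g≤h ¬sh sum<

  -- Going down from t to s, some edge above a subtree z ⊇ s is missing from E: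
  -- otherwise every sibling tree passed would contribute a boundary edge.
  stem : ∀ {A E} S → E ⊆ A → (t : Tree h v) {s : Tree h' u} → Sub d s t → s ⊆ₜ E →
         t ⊆ₜ _⊖_ G A S → ¬ Shallow E g t → suc (sumₜ t (∂ E S)) < g →
         ∃ λ e → e ∉ E × ∃ λ d₁ → ∃ λ d₂ → ∃ λ h₁ → ∃ λ (z : Tree h₁ (src G e)) → Sub d₁ s z × Sub d₂ z t
  stem {g = suc g} S E⊆A t here s⊆ t⊆ ¬sh sum< = ⊥-elim (¬sh (top s⊆))
  stem {g = suc zero} S E⊆A t (left p) s⊆ t⊆ ¬sh (s≤s ())
  stem {g = suc zero} S E⊆A t (right p) s⊆ t⊆ ¬sh (s≤s ())
  stem {g = suc (suc g)} {A} {E} S E⊆A (node c l r) (left p) s⊆ t⊆ ¬sh sum< with eˡ c ∈? E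
  ... | no e∉ = eˡ c , e∉ , _ , 1 , _ , l , p , left here
  ... | yes e∈ with planted-status (_⊖_ G E S) (eʳ c) r
  ...   | inside q = ⊥-elim (¬sh (inʳ (top λ x → ⊖⊆ E {S} (q (inj₂ x)))))
  ...   | outside x∉ _ = ⊥-elim (x∉ (∈Vtx⁺ (⊖-restrict E⊆A e∈ (t⊆ (edgeˡ refl))) (inj₂ (trans (tgtˡ c) (sym (tgtʳ c))))))
  ...   | crossed b with stem S E⊆A l p s⊆ (λ x → t⊆ (inˡ x)) (λ q → ¬sh (inˡ q))
                           (s≤s⁻¹ (≤-trans (s≤s (s≤s (≤-trans (≤-reflexive (+-comm 1 _)) (+-mono-≤ (m≤n+m (sumₜ l (∂ E S)) (∂ E S (eˡ c))) b)))) sum<))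
  ...     | e , e∉ , _ , d₂ , _ , z , q , q' = e , e∉ , _ , suc d₂ , _ , z , q , left q'
  stem {g = suc (suc g)} {A} {E} S E⊆A (node c l r) (right p) s⊆ t⊆ ¬sh sum< with eʳ c ∈? E
  ... | no e∉ = eʳ c , e∉ , _ , 1 , _ , r , p , right here
  ... | yes e∈ with planted-status (_⊖_ G E S) (eˡ c) l
  ...   | inside q = ⊥-elim (¬sh (inˡ (top λ x → ⊖⊆ E {S} (q (inj₂ x)))))
  ...   | outside x∉ _ = ⊥-elim (x∉ (∈Vtx⁺ (⊖-restrict E⊆A e∈ (t⊆ (edgeʳ refl))) (inj₂ (trans (tgtʳ c) (sym (tgtˡ c))))))
  ...   | crossed b with stem S E⊆A r p s⊆ (λ x → t⊆ (inʳ x)) (λ q → ¬sh (inʳ q))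
                           (s≤s⁻¹ (≤-trans (s≤s (s≤s (+-mono-≤ b (m≤n+m (sumₜ r (∂ E S)) (∂ E S (eʳ c)))))) sum<))
  ...     | e , e∉ , _ , d₂ , _ , z , q , q' = e , e∉ , _ , suc d₂ , _ , z , q , right q'

  -- By `stem`, `s` lies in a tree `z` whose top edge is missing from `E`, so the edges of `E` in
  -- `z` are closed under adjacency in `E`. They avoid `S` as edges of A ⊖ S, and V(B) as edges of
  -- `t`.
  detached : ∀ {A E S B} → E ⊆ A → B ⊆ A → ∀ {t : Tree h v} {s : Tree h' u} →
             t ⊆ₜ _⊖_ G A S → (∀ {x} → x ∈ᵥ t → x ∉ Vtx G (_⊖_ G B S)) →
             Sub d s t → s ⊆ₜ E → ¬ Shallow E g t → suc (sumₜ t (∂ E S)) < g →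
             s ⊆ₜ _⊖_ G E (S ∪ Vtx G B)
  detached {A = A} {E} {S} {B} E⊆A B⊆A {t} {s} t⊆ t∩ p s⊆ ¬sh sum< {e} e∈s
    with stem S E⊆A t p s⊆ t⊆ ¬sh sum<
  ... | top-edge , top∉ , _ , _ , _ , z , s≤z , z≤t =
    ⊖-greatest E (λ e → e ∈ E × e ∈ₜ z) proj₁ closed avoids (s⊆ e∈s , Sub-∈ₜ s≤z e∈s)
    where
    closed : ∀ {e f x} → e ∈ E × e ∈ₜ z → e ∋ x → f ∈ E → f ∋ x → f ∈ E × f ∈ₜ z
    closed (_ , e∈z) e∋x f∈E f∋x with incident z (∈ₜ-ends e∈z e∋x) f∋x
    ... | inj₁ f∈z = f∈E , f∈z
    ... | inj₂ eq rewrite src-injective eq = ⊥-elim (top∉ f∈E)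
    avoids : ∀ {e x} → e ∈ E × e ∈ₜ z → e ∋ x → x ∉ S ∪ Vtx G B
    avoids {e} (_ , e∈z) e∋x x∈ with x∈p∪q⁻ S _ x∈
    ... | inj₁ x∈S = ⊖-avoids A (t⊆ (Sub-∈ₜ z≤t e∈z)) e∋x x∈S
    ... | inj₂ x∈B = t∩ (Sub-∈ᵥ z≤t (∈ₜ-ends e∈z e∋x)) (∈Vtx-⊖ B⊆A (t⊆ (Sub-∈ₜ z≤t e∈z)) e∋x x∈B)

  -- E ⊖ T meets `t`, as it contains an edge of `s`, but does not contain all of `t`, which would be
  -- a subtree at depth 0.
  detached-boundary : ∀ {E T} → ∀ {t : Tree h v} {s : Tree h' u} → Sub d s t → 0 < h' →
                      s ⊆ₜ _⊖_ G E T → 0 < g → ¬ Shallow E g t → 1 ≤ sumₜ t (∂ E T)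
  detached-boundary {g = suc _} {E} {T} {t} {node c _ _} p _ s⊆ _ ¬sh with status (_⊖_ G E T) t
  ... | inside t⊆ _ = ⊥-elim (¬sh (top λ x → ⊖⊆ E {T} (t⊆ x)))
  ... | crossed b   = b
  ... | outside t∩  = ⊥-elim (t∩ (Sub-∈ᵥ p (∈ₜ-ends (edgeˡ {c = c} refl) (inj₁ refl)))
                                 (∈Vtx⁺ (s⊆ (edgeˡ refl)) (inj₁ refl)))

-- Pathset complexity and its lower bounds.

module Complexity (G : Graph) (n : ℕ) .{{_ : NonZero n}} 
  (r q : ℕ) .{{_ : NonZero q}} (q≡3*r : q ≡ 3 Data.Nat.* r) where
  open import Data.Nat using (_+_; _*_; _^_; _⊔_)
  open import Data.Nat.Properties
  open import Data.Nat.Tactic.RingSolver using (solve-∀)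
  open import Data.Fin.Subset using (_∈_)
  open import Data.Fin.Subset.Properties using (p⊆p∪q; q⊆p∪q)
  open import Data.Vec.Properties using ([]=⇒lookup; lookup⇒[]=)
  open import Function using (it)
  open Powers
  open Sums
  open Assignments n
  open Subgraphs G
  open JoinTrees G

  private
    N = nV G

  Relation : Set
  Relation = Vec (Fin n) N → Bool

  δ : Subset (nE G) → ℕ
  δ F = sum (boundary F)

  _⊑_ : Relation → Relation → Set
  P ⊑ P' = ∀ x → P x ≡ true → P' x ≡ true

  DependsOn : Subset N → Relation → Set
  DependsOn U P = ∀ x y → (∀ v → v ∈ U → lookup x v ≡ lookup y v) → P x ≡ P y

  -- F|S-pathsets, up to weakening the density bound n ^ (- Δ) to n ^ (- δ / 3).
  record IsPathset (F : Subset (nE G)) (S : Subset N) (P : Relation) : Set where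
    field
      depends : DependsOn (Vtx G F) P
      density : ∀ T → S ⊆ T → ∀ z → n ^ δ (_⊖_ G F T) * ∣ P ∘ mix T z ∣ ^ 3 ≤ (n ^ N) ^ 3
  open IsPathset

  -- Derivations of upper bounds on χ. A covering family is built one piece at a time by `none` and
  -- `union`, so that claims about χ go by induction on derivations; `chi` translates into this
  -- form.
  data Chi : JoinTree G → Subset N → Relation → ℕ → Set where
    none  : ∀ {A S} → Chi A S (λ _ → false) 0
    leaf  : ∀ {l S P} → IsPathset ⟨ leaf {G} l ⟩ S P → Chi (leaf l) S P 1
    node  : ∀ {B C S P P₁ P₂ b c} → IsPathset ⟨ node B C ⟩ S P →
            Chi B S P₁ b → Chi C S P₂ c → P ⊑ P₁ → P ⊑ P₂ → Chi (node B C) S P (b ⊔ c)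
    union : ∀ {A S P P' m m'} → Chi A S P m → Chi A S P' m' → Chi A S (λ x → P x ∨ P' x) (m + m')
    weak  : ∀ {A S P P' m m'} → Chi A S P' m' → P ⊑ P' → m' ≤ m → Chi A S P m

  -- χ ≥ n ^ (X / q) μ, raised to the power q to avoid fractional exponents.
  record Bound (A : JoinTree G) (S : Subset N) (X : ℕ) : Set where
    constructor mkBound
    field
      bound : ∀ {P m} → Chi A S P m → n ^ X * ∣ P ∣ ^ q ≤ (m * n ^ N) ^ q
  open Bound public

  -- Only leaves create cost, and maxima and sums preserve it, so cost 0 comes from empty families.
  -- This lets `piecewise` assume `1 ≤ m`.
  Chi-zero : ∀ {A S P} → Chi A S P 0 → ∀ x → P x ≡ false
  Chi-zero c = go c refl
    where
    go : ∀ {A S P m} → Chi A S P m → m ≡ 0 → ∀ x → P x ≡ false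
    go none _ x = refl
    go {P = P} (node {b = b} _ cB _ P⊑ _) m≡0 x with P x in eq
    ... | false = refl
    ... | true with trans (sym (P⊑ x eq)) (go cB (n≤0⇒n≡0 (≤-trans (m≤m⊔n b _) (≤-reflexive m≡0))) x)
    ...   | ()
    go (union {m = zero} c c') eq x rewrite go c refl x = go c' eq x
    go {P = P} (weak c P⊑ m'≤m) refl x with P x in eq
    ... | false = refl
    ... | true with trans (sym (P⊑ x eq)) (go c (n≤0⇒n≡0 m'≤m) x)
    ...   | ()

  -- Restrict every relation of the derivation. The density condition for `S` ranges over all
  -- supersets of `S`, hence over those of `T`, and `mix-mix` merges the two restrictions.
  Chi-restrict : ∀ {A S T P m} → S ⊆ T → ∀ y → Chi A S P m → Chi A T (P ∘ mix T y) m
  Chi-restrict {T = T'} S⊆T' y = go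
    where
    pathset : ∀ {F S P} → S ⊆ T' → IsPathset F S P → IsPathset F T' (P ∘ mix T' y)
    pathset {F} {P = P} S⊆T' ps .depends x x' eq = ps .depends _ _ λ v v∈ →
      trans (lookup-mix T' y x v) (trans (cong (λ i → if v ∈ᵇ T' then lookup y v else i) (eq v v∈))
                                         (sym (lookup-mix T' y x' v)))
    pathset {F} {P = P} S⊆T' ps .density T T'⊆T z =
      ≤-trans (≤-reflexive (cong (λ m → n ^ δ (_⊖_ G F T) * m ^ 3)
                (total-cong N λ w → cong (𝟙 ∘ P) (mix-mix T' T (λ v v∈ → []=⇒lookup (T'⊆T (lookup⇒[]= v T' v∈))) y z w))))
              (ps .density T (λ x → T'⊆T (S⊆T' x)) (mix T' y z))
    go : ∀ {A P m} → Chi A _ P m → Chi A T' (P ∘ mix T' y) m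
    go none = none
    go (leaf ps) = leaf (pathset S⊆T' ps)
    go (node ps cB cC P⊑ P⊑') = node (pathset S⊆T' ps) (go cB) (go cC) (λ x → P⊑ _) (λ x → P⊑' _)
    go (union c c') = union (go c) (go c')
    go (weak c P⊑ m≤) = weak (go c) (λ x → P⊑ _) m≤

  -- A piece over a node is contained in a relation over each child, and the maximum of the two
  -- costs dominates either one. Dependence on V(D) alone is what later permits conditioning on it.
  project : ∀ {D A S P m} → D ≼ A → Chi A S P m →
            ∃ λ P' → Chi D S P' m × DependsOn (Vtx G ⟨ D ⟩) P' × P ⊑ P'
  project D≼A none = _ , none , (λ _ _ _ → refl) , λ _ ()
  project D≼A (union c c') =
    let P₁ , c₁ , d₁ , ⊑₁ = project D≼A c
        P₂ , c₂ , d₂ , ⊑₂ = project D≼A c'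
    in _ , union c₁ c₂ , (λ x y eq → cong₂ _∨_ (d₁ x y eq) (d₂ x y eq))
       , λ x Px → ∨⁺ (Data.Sum.map (⊑₁ x) (⊑₂ x) (∨⁻ _ Px))
  project D≼A (weak c P⊑ m≤) =
    let P₁ , c₁ , d₁ , ⊑₁ = project D≼A c in P₁ , weak c₁ (λ _ → id) m≤ , d₁ , λ x → ⊑₁ x ∘ P⊑ x
  project here (leaf ps) = _ , leaf ps , ps .depends , λ _ → id
  project here (node ps cB cC P⊑ P⊑') = _ , node ps cB cC P⊑ P⊑' , ps .depends , λ _ → id
  project (left D≼B) (node ps cB cC P⊑ _) =
    let P₁ , c₁ , d₁ , ⊑₁ = project D≼B cB
    in P₁ , weak c₁ (λ _ → id) (m≤m⊔n _ _) , d₁ , λ x → ⊑₁ x ∘ P⊑ x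
  project (right D≼C) (node {b = b} ps cB cC _ P⊑') =
    let P₁ , c₁ , d₁ , ⊑₁ = project D≼C cC
    in P₁ , weak c₁ (λ _ → id) (m≤n⊔m b _) , d₁ , λ x → ⊑₁ x ∘ P⊑' x

  private
    n^≢0 : ∀ {X} → NonZero (n ^ X)
    n^≢0 {X} = m^n≢0 n X

    instance
      n^N≢0 : NonZero (n ^ N)
      n^N≢0 = m^n≢0 n N

    0^ : ∀ q → .{{_ : NonZero q}} → 0 ^ q ≡ 0
    0^ (suc q) = refl

    empty-bound : ∀ X {P : Relation} {y} → (∀ x → P x ≡ false) → n ^ X * ∣ P ∣ ^ q ≤ y
    empty-bound X empty = ≤-trans (≤-reflexive (trans (cong (λ a → n ^ X * a ^ q) (∣∣-∅ empty))
      (trans (cong (n ^ X *_) (0^ q)) (*-zeroʳ (n ^ X))))) z≤n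

  -- Costs and sizes both add up over a union, so by superadditivity it is enough to treat a single
  -- pathset, for which the density bound is also at hand.
  piecewise : ∀ {A S} X → (∀ {P m} → IsPathset ⟨ A ⟩ S P → Chi A S P m → 1 ≤ m →
                           n ^ X * ∣ P ∣ ^ q ≤ (m * n ^ N) ^ q) → Bound A S X
  piecewise {A} {S} X piece = mkBound go
    where
    go : ∀ {P m} → Chi A S P m → n ^ X * ∣ P ∣ ^ q ≤ (m * n ^ N) ^ q
    go {P} none = empty-bound X {P} (λ _ → refl)
    go (leaf ps) = piece ps (leaf ps) ≤-refl
    go {P} {m} c@(node ps cB cC P⊑ P⊑') with m in eq
    ... | zero  = empty-bound X {P} (Chi-zero (subst (Chi _ _ P) eq c))
    ... | suc m = piece ps (subst (Chi _ _ P) eq c) (s≤s z≤n)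
    go (union {P = P} {P'} {m} {m'} c c') = begin
      n ^ X * ∣ (λ x → P x ∨ P' x) ∣ ^ q  ≤⟨ *-monoʳ-≤ (n ^ X) (^-monoˡ-≤ q (∣∣-∨ P P')) ⟩
      n ^ X * (∣ P ∣ + ∣ P' ∣) ^ q        ≤⟨ superadditive (n ^ X) q {{it}} {{n^≢0 {X}}} (go c) (go c') ⟩
      (m * n ^ N + m' * n ^ N) ^ q        ≡⟨ cong (_^ q) (*-distribʳ-+ (n ^ N) m m') ⟨
      ((m + m') * n ^ N) ^ q              ∎
      where open ≤-Reasoning
    go (weak c P⊑ m≤) =
      ≤-trans (*-monoʳ-≤ (n ^ X) (^-monoˡ-≤ q (∣∣-mono P⊑)))
        (≤-trans (go c) (^-monoˡ-≤ q (*-monoˡ-≤ (n ^ N) m≤)))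

  -- The density condition at T = S, averaged over all fibres, bounds `P` itself. Its `r`-th power
  -- turns the exponent δ / 3 into r δ / q.
  pathset-bound : ∀ {F S P} → IsPathset F S P → n ^ (r * δ (_⊖_ G F S)) * ∣ P ∣ ^ q ≤ (n ^ N) ^ q
  pathset-bound {F} {S} {P} ps = begin
    n ^ (r * d) * ∣ P ∣ ^ q          ≡⟨ cong₂ _*_ (trans (cong (n ^_) (*-comm r d)) (sym (^-*-assoc n d r))) (trans (cong (∣ P ∣ ^_) q≡3*r) (sym (^-*-assoc ∣ P ∣ 3 r))) ⟩
    (n ^ d) ^ r * (∣ P ∣ ^ 3) ^ r    ≡⟨ ^-distribʳ-* (n ^ d) (∣ P ∣ ^ 3) r ⟨
    (n ^ d * ∣ P ∣ ^ 3) ^ r          ≤⟨ ^-monoˡ-≤ r (cancel (n ^ N) (∣ P ∣) fibres) ⟩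
    ((n ^ N) ^ 3) ^ r                ≡⟨ trans (^-*-assoc (n ^ N) 3 r) (cong ((n ^ N) ^_) (sym q≡3*r)) ⟩
    (n ^ N) ^ q                      ∎
    where
    open ≤-Reasoning
    d = δ (_⊖_ G F S)
    fibres : n ^ d * (n ^ N * ∣ P ∣) ^ 3 ≤ (n ^ N * n ^ N) ^ 3
    fibres = begin
      n ^ d * (n ^ N * ∣ P ∣) ^ 3                     ≡⟨ cong (λ m → n ^ d * m ^ 3) (total-mix N S (𝟙 ∘ P)) ⟨
      n ^ d * total N (λ z → ∣ P ∘ mix S z ∣) ^ 3     ≤⟨ total-superadditive (n ^ d) 3 {{it}} {{n^≢0 {d}}} N (ps .density S (λ x → x)) ⟩
      total N (λ _ → n ^ N) ^ 3                       ≡⟨ cong (_^ 3) (total-const N (n ^ N)) ⟩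
      (n ^ N * n ^ N) ^ 3                             ∎
    cancel : ∀ M a .{{_ : NonZero M}} → n ^ d * (M * a) ^ 3 ≤ (M * M) ^ 3 → n ^ d * a ^ 3 ≤ M ^ 3
    cancel M a le = *-cancelˡ-≤ (M ^ 3) {{m^n≢0 M 3}} (begin
      M ^ 3 * (n ^ d * a ^ 3)    ≡⟨ swap (M ^ 3) (n ^ d) (a ^ 3) ⟩
      n ^ d * (M ^ 3 * a ^ 3)    ≡⟨ cong (n ^ d *_) (^-distribʳ-* M a 3) ⟨
      n ^ d * (M * a) ^ 3        ≤⟨ le ⟩
      (M * M) ^ 3                ≡⟨ ^-distribʳ-* M M 3 ⟩
      M ^ 3 * M ^ 3              ∎)
      where
      swap : ∀ a b c → a * (b * c) ≡ b * (a * c)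
      swap = solve-∀

  bound-pathset : ∀ A S → Bound A S (r * δ (_⊖_ G ⟨ A ⟩ S))
  bound-pathset A S = piecewise (r * δ (_⊖_ G ⟨ A ⟩ S)) λ {_} {m} ps _ 1≤m →
    ≤-trans (pathset-bound ps) (^-monoˡ-≤ q (m≤n*m (n ^ N) m {{≢-nonZero (m<n⇒n≢0 1≤m)}}))
    where open import Data.Nat using (≢-nonZero)

  bound-≼ : ∀ {D A S X} → D ≼ A → Bound D S X → Bound A S X
  bound-≼ {X = X} D≼A β .bound c =
    let _ , c' , _ , P⊑ = project D≼A c
    in ≤-trans (*-monoʳ-≤ (n ^ X) (^-monoˡ-≤ q (∣∣-mono P⊑))) (β .bound c')

  bound-mono : ∀ {A S X Y} → Y ≤ X → Bound A S X → Bound A S Y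
  bound-mono Y≤X β .bound {P} c =
    ≤-trans (*-monoˡ-≤ (∣ P ∣ ^ q) (^-monoʳ-≤ n Y≤X)) (β .bound c)

  -- A piece over A lies in the join of a relation over D and one over E; once
  -- V(D) is fixed, the latter is bounded through E | S ∪ V(D). The resulting
  -- bound is averaged with the density bound for the piece itself.
  bound-join : ∀ {A D E S X Y Z} → D ≼ A → E ≼ A → Bound D S X → Bound E (S ∪ Vtx G ⟨ D ⟩) Y →
               Z + Z ≤ X + Y + r * δ (_⊖_ G ⟨ A ⟩ S) → Bound A S Z
  bound-join {A} {D} {E} {S} {X} {Y} {Z} D≼A E≼A βD βE Z≤ =
    piecewise Z λ {P} {m} ps c _ →
      let P₁ , c₁ , d₁ , ⊑₁ = project D≼A c
          P₂ , c₂ , _  , ⊑₂ = project E≼A c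
          fibres = ∣∣-∧-mix (n ^ Y) q {{it}} {{n^≢0 {Y}}} U {P₁} {P₂} {m * n ^ N}
                     (λ z w → d₁ _ _ (λ v v∈ → trans (lookup-mix U z w v)
                       (cong (λ b → if b then lookup z v else lookup w v) ([]=⇒lookup (q⊆p∪q S _ v∈)))))
                     (λ z → βE .bound (Chi-restrict {S = S} (p⊆p∪q _) z c₂))
      in average ∣ P ∣ ∣ P₁ ∣ m (n ^ N) (βD .bound c₁)
           (≤-trans (*-monoʳ-≤ (n ^ Y) (^-monoˡ-≤ q (*-monoʳ-≤ (n ^ N)
              (∣∣-mono {P = P} λ x Px → ∧⁺ (⊑₁ x Px) (⊑₂ x Px))))) fibres)
           (pathset-bound ps)
    where
    U = S ∪ Vtx G ⟨ D ⟩
    W = r * δ (_⊖_ G ⟨ A ⟩ S)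
    -- Eliminating `a₁` from the first two bounds gives n^(X+Y) a^q ≤ m^(2q) M^q. Multiplied by the
    -- third, the right side becomes the square of (m M)^q; hence the condition on `Z + Z`.
    average : ∀ a a₁ m M .{{_ : NonZero M}} → n ^ X * a₁ ^ q ≤ (m * M) ^ q →
              n ^ Y * (M * a) ^ q ≤ (a₁ * (m * M)) ^ q → n ^ W * a ^ q ≤ M ^ q →
              n ^ Z * a ^ q ≤ (m * M) ^ q
    average a a₁ m M le₁ le₂ le₃ = ^-cancelˡ-≤ 2 (begin
      (n ^ Z * a ^ q) ^ 2                          ≡⟨ square (n ^ Z) (a ^ q) ⟩
      (n ^ Z * n ^ Z) * (a ^ q * a ^ q)            ≡⟨ cong (_* (a ^ q * a ^ q)) (^-distribˡ-+-* n Z Z) ⟨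
      n ^ (Z + Z) * (a ^ q * a ^ q)                ≤⟨ *-monoˡ-≤ (a ^ q * a ^ q) (^-monoʳ-≤ n Z≤) ⟩
      n ^ (X + Y + W) * (a ^ q * a ^ q)            ≡⟨ cong (_* (a ^ q * a ^ q)) (trans (^-distribˡ-+-* n (X + Y) W) (cong (_* n ^ W) (^-distribˡ-+-* n X Y))) ⟩
      n ^ X * n ^ Y * n ^ W * (a ^ q * a ^ q)      ≡⟨ regroup (n ^ X) (n ^ Y) (n ^ W) (a ^ q) ⟩
      n ^ X * ((n ^ Y * a ^ q) * (n ^ W * a ^ q))  ≤⟨ *-monoʳ-≤ (n ^ X) (*-mono-≤ le₂' le₃) ⟩
      n ^ X * ((a₁ * m) ^ q * M ^ q)               ≡⟨ cong (λ y → n ^ X * (y * M ^ q)) (^-distribʳ-* a₁ m q) ⟩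
      n ^ X * (a₁ ^ q * m ^ q * M ^ q)             ≡⟨ assoc (n ^ X) (a₁ ^ q) (m ^ q) (M ^ q) ⟩
      n ^ X * a₁ ^ q * (m ^ q * M ^ q)             ≤⟨ *-monoˡ-≤ (m ^ q * M ^ q) le₁ ⟩
      (m * M) ^ q * (m ^ q * M ^ q)                ≡⟨ cong ((m * M) ^ q *_) (^-distribʳ-* m M q) ⟨
      (m * M) ^ q * (m * M) ^ q                    ≡⟨ cong ((m * M) ^ q *_) (*-identityʳ _) ⟨
      ((m * M) ^ q) ^ 2                            ∎)
      where
      open ≤-Reasoning
      square : ∀ a b → (a * b) * ((a * b) * 1) ≡ (a * a) * (b * b)
      square = solve-∀
      regroup : ∀ x y w a → x * y * w * (a * a) ≡ x * ((y * a) * (w * a))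
      regroup = solve-∀
      assoc : ∀ x a b c → x * (a * b * c) ≡ x * a * (b * c)
      assoc = solve-∀
      le₂' : n ^ Y * a ^ q ≤ (a₁ * m) ^ q
      le₂' = *-cancelʳ-≤ _ _ (M ^ q) {{m^n≢0 M q}} (begin
        n ^ Y * a ^ q * M ^ q    ≡⟨ *-assoc (n ^ Y) _ _ ⟩
        n ^ Y * (a ^ q * M ^ q)  ≡⟨ cong (n ^ Y *_) (trans (*-comm (a ^ q) _) (sym (^-distribʳ-* M a q))) ⟩
        n ^ Y * (M * a) ^ q      ≤⟨ le₂ ⟩
        (a₁ * (m * M)) ^ q       ≡⟨ cong (_^ q) (*-assoc a₁ m M) ⟨
        (a₁ * m * M) ^ q         ≡⟨ ^-distribʳ-* (a₁ * m) M q ⟩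
        (a₁ * m) ^ q * M ^ q     ∎)

-- The induction on join-trees.

module Potential (G : Graph) (src-injective : ∀ {e f} → src G e ≡ src G f → e ≡ f)
  {k ρ} (whole : Trees.Tree G src-injective k ρ)
  (sum-whole : ∀ f → Trees.sumₜ G src-injective whole f ≤ Sums.sum f)
  (n : ℕ) .{{_ : NonZero n}} (q : ℕ) .{{_ : NonZero q}} (q≡108 : q ≡ 108) where
  open import Data.Nat using (_+_; _*_; _∸_; _<_)
  open import Data.Nat.Properties
  open import Data.Nat.Tactic.RingSolver using (solve-∀)
  open Subgraphs G
  open JoinTrees G
  open Trees G src-injective
  open Breaking G src-injective
  open Complexity G n 36 q q≡108

  private
    open ≤-Reasoning

    sum≤δ : ∀ {h v d} {t : Tree h v} F → Sub d t whole → sumₜ t (boundary F) ≤ δ F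
    sum≤δ F p = ≤-trans (Sub-sumₜ p (boundary F)) (sum-whole (boundary F))

    ∸8-shift : ∀ {h} d h' → h ≡ d + h' → h ∸ 8 ≤ d + (h' ∸ 8)
    ∸8-shift {h} d h' refl = m≤n+o⇒m∸n≤o (d + h') 8 (begin
      d + h'              ≤⟨ +-monoʳ-≤ d (m≤n+m∸n h' 8) ⟩
      d + (8 + (h' ∸ 8))  ≡⟨ shuffle d (h' ∸ 8) ⟩
      8 + (d + (h' ∸ 8))  ∎)
      where
      shuffle : ∀ d x → d + (8 + x) ≡ 8 + (d + x)
      shuffle = solve-∀

    -- The offset 8 makes h ∸ 8 at most 8 t, also when t = 0, and 8 + 12 ≤ 36.
    small-height : ∀ {h t} → h ≤ 8 * suc t → (h ∸ 8) + 12 * t ≤ 36 * t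
    small-height {h} {t} h≤ = begin
      (h ∸ 8) + 12 * t  ≤⟨ +-monoˡ-≤ (12 * t) (m≤n+o⇒m∸n≤o h 8 (≤-trans h≤ (≤-reflexive (*-suc 8 t)))) ⟩
      8 * t + 12 * t    ≡⟨ *-distribʳ-+ t 8 12 ⟨
      20 * t            ≤⟨ *-monoˡ-≤ t (m≤m+n 20 16) ⟩
      36 * t            ∎

    -- With s = t + 1, the descent costs at most 5 s + ∂ and the old boundary at most 12 s. Of the
    -- gain 12 ∂, one ∂ pays for the descent and 11 ∂ ≥ 22 s covers the rest.
    large-boundary : ∀ {h d h' t ∂} → h ≡ d + h' → d ≤ 5 * suc t + ∂ → 2 * suc t ≤ ∂ →
                     (h ∸ 8) + 12 * t ≤ (h' ∸ 8) + 12 * ∂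
    large-boundary {h} {d} {h'} {t} {∂} eq d≤ ∂≥ = begin
      (h ∸ 8) + 12 * t                     ≤⟨ +-mono-≤ (∸8-shift d h' eq) (*-monoʳ-≤ 12 (n≤1+n t)) ⟩
      d + x + 12 * s                       ≤⟨ +-monoˡ-≤ (12 * s) (+-monoˡ-≤ x d≤) ⟩
      5 * s + ∂ + x + 12 * s               ≤⟨ m≤m+n _ (5 * s) ⟩
      5 * s + ∂ + x + 12 * s + 5 * s       ≡⟨ collect s ∂ x ⟩
      x + (11 * (2 * s) + ∂)               ≤⟨ +-monoʳ-≤ x (+-monoˡ-≤ ∂ (*-monoʳ-≤ 11 ∂≥)) ⟩
      x + (11 * ∂ + ∂)                     ≡⟨ cong (x +_) (+-comm (11 * ∂) ∂) ⟩
      x + 12 * ∂                           ∎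
      where
      s = suc t
      x = h' ∸ 8
      collect : ∀ s ∂ x → 5 * s + ∂ + x + 12 * s + 5 * s ≡ x + (11 * (2 * s) + ∂)
      collect = solve-∀

    -- The descents cost at most 10 (t + 1) + ∂₁ together, so 34 t + 10 + ∂₁ stands against 12 ∂₁ +
    -- 12 ∂₂ + 36 t. The constant 10 is paid for by a single edge of the second boundary.
    balance : ∀ {h d₁ h₁ d₂ h₂ t ∂₁ ∂₂} → h ≡ d₁ + h₁ → h ≡ d₂ + h₂ →
              d₁ ≤ 3 * suc t + ∂₁ → d₂ < 7 * suc t → 1 ≤ ∂₂ →
              ((h ∸ 8) + 12 * t) + ((h ∸ 8) + 12 * t) ≤
              ((h₁ ∸ 8) + 12 * ∂₁) + ((h₂ ∸ 8) + 12 * ∂₂) + 36 * t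
    balance {h} {d₁} {h₁} {d₂} {h₂} {t} {∂₁} {∂₂} eq₁ eq₂ d₁≤ d₂< 1≤ = begin
      ((h ∸ 8) + 12 * t) + ((h ∸ 8) + 12 * t)
        ≤⟨ +-mono-≤ (+-monoˡ-≤ (12 * t) (∸8-shift d₁ h₁ eq₁)) (+-monoˡ-≤ (12 * t) (∸8-shift d₂ h₂ eq₂)) ⟩
      (d₁ + x + 12 * t) + (d₂ + y + 12 * t)
        ≤⟨ +-mono-≤ (+-monoˡ-≤ (12 * t) (+-monoˡ-≤ x d₁≤))
                    (+-monoˡ-≤ (12 * t) (+-monoˡ-≤ y (≤-trans (n≤1+n d₂) d₂<))) ⟩
      (3 * suc t + ∂₁ + x + 12 * t) + (7 * suc t + y + 12 * t)
        ≤⟨ m≤m+n _ (2 + 11 * ∂₁ + 2 * t) ⟩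
      (3 * suc t + ∂₁ + x + 12 * t) + (7 * suc t + y + 12 * t) + (2 + 11 * ∂₁ + 2 * t)
        ≡⟨ collect t x y ∂₁ ⟩
      (x + 12 * ∂₁) + (y + 12 * 1) + 36 * t
        ≤⟨ +-monoˡ-≤ (36 * t) (+-monoʳ-≤ (x + 12 * ∂₁) (+-monoʳ-≤ y (*-monoʳ-≤ 12 1≤))) ⟩
      (x + 12 * ∂₁) + (y + 12 * ∂₂) + 36 * t ∎
      where
      x = h₁ ∸ 8
      y = h₂ ∸ 8
      collect : ∀ t x y ∂ → (3 * suc t + ∂ + x + 12 * t) + (7 * suc t + y + 12 * t) + (2 + 11 * ∂ + 2 * t)
                            ≡ (x + 12 * ∂) + (y + 12) + 36 * t
      collect = solve-∀

    remaining : ∀ a b {h d h'} s → h ≡ d + h' → (a + b) * s < h → d ≤ a * s → b * s < h'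
    remaining a b {h} {d} {h'} s refl lt d≤ = +-cancelˡ-< (a * s) _ _ (begin-strict
      a * s + b * s  ≡⟨ *-distribʳ-+ s a b ⟨
      (a + b) * s    <⟨ lt ⟩
      d + h'         ≤⟨ +-monoˡ-≤ h' d≤ ⟩
      a * s + h'     ∎)

  -- In terms of q = 108, a subtree of height h and a boundary of size δ together
  -- are worth (h - 8) + 12 δ, while the density bound alone is worth 36 δ.
  Claim : JoinTree G → Set
  Claim A = ∀ S {h v d} (t : Tree h v) → Sub d t whole → t ⊆ₜ _⊖_ G ⟨ A ⟩ S →
            Bound A S ((h ∸ 8) + 12 * δ (_⊖_ G ⟨ A ⟩ S))

  module Step {A} (ih : ∀ D → D ≺ A → Claim D) S {h v d₀} (t : Tree h v) (t≤ : Sub d₀ t whole)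
              (t⊆ : t ⊆ₜ _⊖_ G ⟨ A ⟩ S) where

    ∂A s : ℕ
    ∂A = δ (_⊖_ G ⟨ A ⟩ S)
    s = suc ∂A

    restrict : ∀ {D h' u} {t' : Tree h' u} {d} → D ≺ A → Sub d t' t → t' ⊆ₜ ⟨ D ⟩ → t' ⊆ₜ _⊖_ G ⟨ D ⟩ S
    restrict D≺A p t'⊆ e∈ = ⊖-restrict (≼⇒⊆ (≺⇒≼ D≺A)) (t'⊆ e∈) (t⊆ (Sub-∈ₜ p e∈))

    -- The allowance 5 s covers both uses: breaking `t` takes 3 s, and breaking `ty` takes 3 s below
    -- a root at depth at most 2 s.
    from-large-boundary : ∀ {D h' u} (t' : Tree h' u) {d} → D ≺ A → Sub d t' t → t' ⊆ₜ ⟨ D ⟩ →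
                          d ≤ 5 * s + δ (_⊖_ G ⟨ D ⟩ S) → 2 * s ≤ δ (_⊖_ G ⟨ D ⟩ S) →
                          Bound A S ((h ∸ 8) + 12 * ∂A)
    from-large-boundary {D} {h'} t' D≺A p t'⊆ d≤ ∂≥ =
      bound-mono (large-boundary {t = ∂A} (Sub-height p) d≤ ∂≥)
        (bound-≼ {X = (h' ∸ 8) + 12 * δ (_⊖_ G ⟨ D ⟩ S)} (≺⇒≼ D≺A)
          (ih D D≺A S t' (Sub-trans p t≤) (restrict D≺A p t'⊆)))

    module Tall (8s<h : 8 * s < h) where

      3s≤h : 3 * s ≤ h
      3s≤h = ≤-trans (*-monoˡ-≤ s (m≤m+n 3 5)) (<⇒≤ 8s<h)

      2s<3s : 2 * s < 3 * s
      2s<3s = *-monoˡ-< s (n<1+n 2)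

      goal : Bound A S ((h ∸ 8) + 12 * ∂A)
      goal with break A S t (3 * s) (s≤s z≤n) 3s≤h t⊆
      ... | B , B≺A , ¬shB , dB , hB , _ , tB , pB , tB⊆ , dB≤ with δ (_⊖_ G ⟨ B ⟩ S) <? 2 * s
      ...   | no ≮ = from-large-boundary tB B≺A pB tB⊆
                (≤-trans dB≤ (+-mono-≤ (*-monoˡ-≤ s (m≤m+n 3 2)) (sum≤δ (_⊖_ G ⟨ B ⟩ S) t≤))) (≮⇒≥ ≮)
      ...   | yes ∂B< with avoiding ⟨ B ⟩ S t (2 * s) 2s<3s 3s≤h ¬shB (≤-<-trans (sum≤δ (_⊖_ G ⟨ B ⟩ S) t≤) ∂B<)
      ...     | dy , hy , _ , ty , py , dy≤ , ty∩
              with break A S ty (3 * s) (s≤s z≤n)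
                     -- Below depth 2 s more than 6 s of the height is left, enough for the
                     -- threshold 3 s.
                     (≤-trans (*-monoˡ-≤ s (m≤m+n 3 3)) (<⇒≤ (remaining 2 6 s (Sub-height py) 8s<h dy≤)))
                     (λ x → t⊆ (Sub-∈ₜ py x))
      ...       | E , E≺A , ¬shE , dE , hE , _ , tE , pE , tE⊆ , dE≤ with δ (_⊖_ G ⟨ E ⟩ S) <? 2 * s
      ...         | no ≮ = from-large-boundary tE E≺A (Sub-trans pE py) tE⊆
                      (depth (≤-trans dE≤ (+-monoʳ-≤ (3 * s) (sum≤δ (_⊖_ G ⟨ E ⟩ S) (Sub-trans py t≤))))) (≮⇒≥ ≮)
        where
        depth : ∀ {x} → dE ≤ 3 * s + x → dy + dE ≤ 5 * s + x
        depth {x} le = ≤-trans (+-mono-≤ dy≤ le) (≤-reflexive (eq s x))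
          where
          eq : ∀ s x → 2 * s + (3 * s + x) ≡ 5 * s + x
          eq = solve-∀
      ...         | yes ∂E< =
        bound-join {X = (hB ∸ 8) + 12 * δ (_⊖_ G ⟨ B ⟩ S)} {Y = (hE ∸ 8) + 12 * ∂E} (≺⇒≼ B≺A) (≺⇒≼ E≺A)
          (ih B B≺A S tB (Sub-trans pB t≤) (restrict B≺A pB tB⊆))
          (ih E E≺A _ tE (Sub-trans (Sub-trans pE py) t≤) tE-detached)
          (balance {d₁ = dB} {h₁ = hB} {d₂ = dy + dE} {h₂ = hE} {t = ∂A} (Sub-height pB) (Sub-height (Sub-trans pE py))
            (≤-trans dB≤ (+-monoʳ-≤ (3 * s) (sum≤δ (_⊖_ G ⟨ B ⟩ S) t≤))) depth
            (≤-trans (detached-boundary {g = 3 * s} pE tE-nonempty tE-detached (s≤s z≤n) ¬shE)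
                     (sum≤δ (_⊖_ G ⟨ E ⟩ (S ∪ Vtx G ⟨ B ⟩)) (Sub-trans py t≤))))
        where
        ∂E = δ (_⊖_ G ⟨ E ⟩ (S ∪ Vtx G ⟨ B ⟩))
        sum< : sumₜ ty (boundary (_⊖_ G ⟨ E ⟩ S)) < 2 * s
        sum< = ≤-<-trans (sum≤δ (_⊖_ G ⟨ E ⟩ S) (Sub-trans py t≤)) ∂E<
        tE-detached : tE ⊆ₜ _⊖_ G ⟨ E ⟩ (S ∪ Vtx G ⟨ B ⟩)
        tE-detached = detached (≼⇒⊆ (≺⇒≼ E≺A)) (≼⇒⊆ (≺⇒≼ B≺A)) (λ x → t⊆ (Sub-∈ₜ py x)) ty∩ pE tE⊆ ¬shE
                        (≤-<-trans sum< 2s<3s)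
        depth : dy + dE < 7 * s
        depth = ≤-<-trans (+-mono-≤ dy≤ dE≤)
                  (<-≤-trans (+-monoʳ-< (2 * s) (+-monoʳ-< (3 * s) sum<)) (≤-reflexive (eq s)))
          where
          eq : ∀ s → 2 * s + (3 * s + 2 * s) ≡ 7 * s
          eq = solve-∀
        -- The depth stays below 2 s + 3 s + 2 s = 7 s, so height above 8 s leaves `tE` an edge.
        tE-nonempty : 0 < hE
        tE-nonempty = ≤-<-trans z≤n (remaining 7 1 s (Sub-height (Sub-trans pE py)) 8s<h (<⇒≤ depth))

  potential : ∀ A → Claim A
  potential = ≺-induction Claim λ A ih S {h} t t≤ t⊆ →
    let open Step ih S t t≤ t⊆ in
    case h ≤? 8 * s of λ
      { (yes h≤) → bound-mono (small-height {t = ∂A} h≤) (bound-pathset A S)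
      ; (no h≰)  → Tall.goal (≰⇒> h≰) }

-- Heap-indexed sums as sums over intervals.

module Ranges where
  open import Data.Nat using (_+_; _*_; _^_; _∸_)
  open import Data.Nat.Properties
  open import Data.Nat.Tactic.RingSolver using (solve-∀)
  open import Data.Fin.Properties using (fromℕ<-toℕ; toℕ<n)
  open Sums

  range : ℕ → ℕ → (ℕ → ℕ) → ℕ
  range a zero    f = 0
  range a (suc c) f = f a + range (suc a) c f

  range-++ : ∀ a c c' f → range a (c + c') f ≡ range a c f + range (a + c) c' f
  range-++ a zero    c' f = cong (λ b → range b c' f) (sym (+-identityʳ a))
  range-++ a (suc c) c' f = trans (cong (f a +_) (trans (range-++ (suc a) c c' f)
    (cong (λ b → range (suc a) c f + range b c' f) (sym (+-suc a c))))) (sym (+-assoc (f a) _ _))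

  sum≡range : ∀ m a (f : ℕ → ℕ) → sum {m} (λ i → f (a + toℕ i)) ≡ range a m f
  sum≡range zero    a f = refl
  sum≡range (suc m) a f = cong₂ _+_ (cong f (+-identityʳ a))
    (trans (sum-cong-≗ {m} λ i → cong f (+-suc a (toℕ i))) (sum≡range m (suc a) f))

  -- Extension by zero, so that heap indices can be computed in ℕ without carrying bounds.
  extend : ∀ {m} → (Fin m → ℕ) → ℕ → ℕ
  extend {m} f j with j <? m
  ... | yes j<m = f (fromℕ< j<m)
  ... | no _    = 0

  extend-toℕ : ∀ {m} (f : Fin m → ℕ) i → extend f (toℕ i) ≡ f i
  extend-toℕ {m} f i with toℕ i <? m
  ... | yes p = cong f (fromℕ<-toℕ i p)
  ... | no ≮  = ⊥-elim (≮ (toℕ<n i))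

  sum≡range-extend : ∀ {m} (f : Fin m → ℕ) → sum f ≡ range 0 m (extend f)
  sum≡range-extend {m} f =
    trans (sum-cong-≗ {m} λ i → sym (extend-toℕ f i)) (sum≡range m 0 (extend f))

  -- Sum of f over the heap indices of the edges below vertex i, to depth h.
  heapSum : ℕ → ℕ → (ℕ → ℕ) → ℕ
  heapSum zero    i f = 0
  heapSum (suc h) i f = (f (2 * i) + heapSum h (suc (2 * i)) f)
                      + (f (suc (2 * i)) + heapSum h (suc (suc (2 * i))) f)

  private
    edges : ℕ → ℕ → ℕ
    edges zero    c = 0
    edges (suc h) c = 2 * c + edges h (2 * c)

    edges-closed : ∀ h c → edges h c + 2 * c ≡ 2 * c * 2 ^ h
    edges-closed zero    c = sym (*-identityʳ (2 * c))
    edges-closed (suc h) c = trans (shuffle c (edges h (2 * c)))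
      (trans (edges-closed h (2 * c)) (double c (2 ^ h)))
      where
      shuffle : ∀ c e → 2 * c + e + 2 * c ≡ e + 2 * (2 * c)
      shuffle = solve-∀
      double : ∀ c p → 2 * (2 * c) * p ≡ 2 * c * (2 * p)
      double = solve-∀

    -- Below consecutive vertices from `a` hang consecutive edges from `2 * a`, with consecutive
    -- lower ends from `suc (2 * a)`.
    level : ∀ h a c f → range a c (λ i → heapSum (suc h) i f)
                        ≡ range (2 * a) (2 * c) f + range (suc (2 * a)) (2 * c) (λ i → heapSum h i f)
    level h a zero    f = refl
    level h a (suc c) f = begin
      heapSum (suc h) a f + range (suc a) c (λ i → heapSum (suc h) i f)
        ≡⟨ cong (heapSum (suc h) a f +_) (level h (suc a) c f) ⟩
      heapSum (suc h) a f + (range (2 * suc a) (2 * c) f + range (suc (2 * suc a)) (2 * c) H)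
        ≡⟨ cong (λ b → heapSum (suc h) a f + (range b (2 * c) f + range (suc b) (2 * c) H)) (*-suc 2 a) ⟩
      heapSum (suc h) a f + (range (2 + 2 * a) (2 * c) f + range (3 + 2 * a) (2 * c) H)
        ≡⟨ shuffle (f (2 * a)) (f (suc (2 * a))) (H (suc (2 * a))) (H (suc (suc (2 * a)))) _ _ ⟩
      range (2 * a) (2 + 2 * c) f + range (suc (2 * a)) (2 + 2 * c) H
        ≡⟨ cong (λ d → range (2 * a) d f + range (suc (2 * a)) d H) (*-suc 2 c) ⟨
      range (2 * a) (2 * suc c) f + range (suc (2 * a)) (2 * suc c) H ∎
      where
      open ≡-Reasoning
      H : ℕ → ℕ
      H i = heapSum h i f
      shuffle : ∀ x y p q r s → (x + p) + (y + q) + (r + s) ≡ (x + (y + r)) + (p + (q + s))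
      shuffle = solve-∀

    -- A full level that starts at `a` has `suc a` vertices. Its edges end just before 2 (2 a + 1),
    -- where those of the next level begin.
    levels : ∀ h a f → range a (suc a) (λ i → heapSum h i f) ≡ range (2 * a) (edges h (suc a)) f
    levels zero    a f = zeros a (suc a)
      where
      zeros : ∀ a c → range a c (λ _ → 0) ≡ 0
      zeros a zero    = refl
      zeros a (suc c) = zeros (suc a) c
    levels (suc h) a f = begin
      range a (suc a) (λ i → heapSum (suc h) i f)
        ≡⟨ level h a (suc a) f ⟩
      range (2 * a) (2 * suc a) f + range (suc (2 * a)) (2 * suc a) (λ i → heapSum h i f)
        ≡⟨ cong (λ c → range (2 * a) (2 * suc a) f + range (suc (2 * a)) c (λ i → heapSum h i f)) (*-suc 2 a) ⟩
      range (2 * a) (2 * suc a) f + range (suc (2 * a)) (suc (suc (2 * a))) (λ i → heapSum h i f)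
        ≡⟨ cong (range (2 * a) (2 * suc a) f +_) (levels h (suc (2 * a)) f) ⟩
      range (2 * a) (2 * suc a) f + range (2 * suc (2 * a)) (edges h (suc (suc (2 * a)))) f
        ≡⟨ cong₂ (λ b c → range (2 * a) (2 * suc a) f + range b (edges h c) f) (shift a) (sym (*-suc 2 a)) ⟩
      range (2 * a) (2 * suc a) f + range (2 * a + 2 * suc a) (edges h (2 * suc a)) f
        ≡⟨ range-++ (2 * a) (2 * suc a) _ f ⟨
      range (2 * a) (edges (suc h) (suc a)) f ∎
      where
      open ≡-Reasoning
      shift : ∀ a → 2 * suc (2 * a) ≡ 2 * a + 2 * suc a
      shift = solve-∀

  heapSum≡range : ∀ k f → heapSum k 0 f ≡ range 0 (2 ^ suc k ∸ 2) f
  heapSum≡range k f = trans (sym (+-identityʳ _)) (trans (levels k 0 f)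
    (cong (λ c → range 0 c f) (trans (sym (m+n∸n≡m (edges k 1) 2)) (cong (_∸ 2) (edges-closed k 1)))))

-- The tree `T k` and the random walk on it.

module Heap (k : ℕ) where
  open import Data.Nat using (_+_; _*_; _^_; _∸_; _<_)
  open import Data.Nat.Properties hiding (suc-injective)
  open import Data.Nat.DivMod using (_/_; _%_; m*n/n≡m; m≡m%n+[m/n]*n; m%n<n)
  open import Data.Nat.Tactic.RingSolver using (solve-∀)
  open import Relation.Nullary.Decidable using (does; dec-true; dec-false)
  open import Data.Fin.Properties using (toℕ-fromℕ<; toℕ-injective; suc-injective; toℕ<n)
  open Sums
  open Ranges

  src-injective : ∀ {e f} → src (T k) e ≡ src (T k) f → e ≡ f
  src-injective = suc-injective

  open Subgraphs (T k) using (Edge; Vertex)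
  open Trees (T k) src-injective

  private
    m = 2 ^ suc k ∸ 2

    toℕ-tgt : ∀ e → toℕ (tgt (T k) e) ≡ toℕ e / 2
    toℕ-tgt e = toℕ-fromℕ< _

    half : ∀ j i → j / 2 ≡ i → j ≡ 2 * i ⊎ j ≡ suc (2 * i)
    half j i refl with j % 2 | m%n<n j 2 | m≡m%n+[m/n]*n j 2
    ... | 0 | _ | eq = inj₁ (trans eq (*-comm (j / 2) 2))
    ... | 1 | _ | eq = inj₂ (trans eq (cong suc (*-comm (j / 2) 2)))
    ... | suc (suc _) | s≤s (s≤s ()) | _

  -- Vertex i (with heap numbering from 0) has height h.
  record AtHeight (h i : ℕ) : Set where
    field
      lower : 2 ^ k ≤ suc i * 2 ^ h
      upper : suc (suc i) * 2 ^ h ≤ 2 ^ suc k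
  open AtHeight

  private
    root-height : AtHeight k 0
    root-height = record { lower = ≤-reflexive (sym (*-identityˡ _)) ; upper = ≤-refl }

    double : ∀ i p → i * (2 * p) ≡ (2 * i) * p
    double = solve-∀

    childˡ-height : ∀ {h i} → AtHeight (suc h) i → AtHeight h (suc (2 * i))
    childˡ-height {h} {i} a = record
      { lower = ≤-trans (a .lower) (≤-reflexive (trans (double (suc i) (2 ^ h)) (cong (λ j → j * 2 ^ h) (*-suc 2 i))))
      ; upper = ≤-trans (*-monoˡ-≤ (2 ^ h) (n≤1+n (suc (suc (suc (2 * i))))))
          (≤-trans (≤-reflexive (sym (trans (double (suc (suc i)) (2 ^ h)) (cong (λ j → j * 2 ^ h) (shift i))))) (a .upper)) }
      where
      shift : ∀ i → 2 * suc (suc i) ≡ suc (suc (suc (suc (2 * i))))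
      shift = solve-∀

    childʳ-height : ∀ {h i} → AtHeight (suc h) i → AtHeight h (suc (suc (2 * i)))
    childʳ-height {h} {i} a = record
      { lower = ≤-trans (childˡ-height a .lower) (*-monoˡ-≤ (2 ^ h) (n≤1+n (suc (suc (2 * i)))))
      ; upper = ≤-trans (≤-reflexive (sym (trans (double (suc (suc i)) (2 ^ h)) (cong (λ j → j * 2 ^ h) (shift i))))) (a .upper) }
      where
      shift : ∀ i → 2 * suc (suc i) ≡ suc (suc (suc (suc (2 * i))))
      shift = solve-∀

    edges-exist : ∀ {h i} → AtHeight (suc h) i → suc (2 * i) < m
    edges-exist {h} {i} a = m+n≤o⇒m≤o∸n (suc (suc (2 * i))) (begin
      suc (suc (2 * i)) + 2     ≡⟨ shift i ⟩
      suc (suc i) * 2           ≤⟨ *-monoʳ-≤ (suc (suc i)) (m≤m*n 2 (2 ^ h) {{m^n≢0 2 h}}) ⟩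
      suc (suc i) * 2 ^ suc h   ≤⟨ a .upper ⟩
      2 ^ suc k                 ∎)
      where
      open ≤-Reasoning
      shift : ∀ i → suc (suc (2 * i)) + 2 ≡ suc (suc i) * 2
      shift = solve-∀

    no-edges : ∀ {i} → AtHeight 0 i → m ≤ 2 * i
    no-edges {i} a = m≤n+o⇒m∸n≤o (2 ^ suc k) 2
      (≤-trans (*-monoʳ-≤ 2 (≤-trans (a .lower) (≤-reflexive (*-identityʳ (suc i))))) (≤-reflexive (*-suc 2 i)))

  fork : ∀ {h} v → AtHeight (suc h) (toℕ v) → Fork v
  fork v a = record
    { eˡ = l ; eʳ = r
    ; tgtˡ = toℕ-injective (trans (toℕ-tgt l) (trans (cong (_/ 2) toℕ-l) (trans (cong (_/ 2) (*-comm 2 i)) (m*n/n≡m i 2))))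
    ; tgtʳ = toℕ-injective (trans (toℕ-tgt r) (trans (cong (_/ 2) toℕ-r) (odd i)))
    ; distinct = λ eq → 1+n≢n (trans (sym toℕ-r) (trans (sym (cong toℕ eq)) toℕ-l))
    ; complete = λ e eq → Data.Sum.map
        (λ q → toℕ-injective (trans q (sym toℕ-l))) (λ q → toℕ-injective (trans q (sym toℕ-r)))
        (half (toℕ e) i (trans (sym (toℕ-tgt e)) (cong toℕ eq)))
    }
    where
    i = toℕ v
    l r : Edge
    l = fromℕ< (<⇒≤ (edges-exist a))
    r = fromℕ< (edges-exist a)
    toℕ-l : toℕ l ≡ 2 * i
    toℕ-l = toℕ-fromℕ< _
    toℕ-r : toℕ r ≡ suc (2 * i)
    toℕ-r = toℕ-fromℕ< _
    odd : ∀ i → suc (2 * i) / 2 ≡ i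
    odd i with half (suc (2 * i)) (suc (2 * i) / 2) refl
    ... | inj₁ eq = ⊥-elim (even≢odd (suc (2 * i) / 2) i (sym eq))
    ... | inj₂ eq = sym (*-cancelˡ-≡ i _ 2 (Data.Nat.Properties.suc-injective eq))

  private
    heightˡ : ∀ {h} v (a : AtHeight (suc h) (toℕ v)) → AtHeight h (suc (toℕ (eˡ (fork v a))))
    heightˡ v a = subst (AtHeight _ ∘ suc) (sym (toℕ-fromℕ< _)) (childˡ-height a)
    heightʳ : ∀ {h} v (a : AtHeight (suc h) (toℕ v)) → AtHeight h (suc (toℕ (eʳ (fork v a))))
    heightʳ v a = subst (AtHeight _ ∘ suc) (sym (toℕ-fromℕ< _)) (childʳ-height a)

  heap : ∀ h v → AtHeight h (toℕ v) → Tree h v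
  heap zero v a = leaf λ e eq → <⇒≱ (toℕ<n e) (≤-trans (no-edges a) (bound e (half (toℕ e) (toℕ v)
                    (trans (sym (toℕ-tgt e)) (cong toℕ eq)))))
    where
    bound : ∀ e → toℕ e ≡ 2 * toℕ v ⊎ toℕ e ≡ suc (2 * toℕ v) → 2 * toℕ v ≤ toℕ e
    bound e (inj₁ eq) = ≤-reflexive (sym eq)
    bound e (inj₂ eq) = ≤-trans (n≤1+n _) (≤-reflexive (sym eq))
  heap (suc h) v a = node (fork v a) (heap h _ (heightˡ v a)) (heap h _ (heightʳ v a))

  sum-heap : ∀ h v a f → sumₜ (heap h v a) f ≡ heapSum h (toℕ v) (extend f)
  sum-heap zero    v a f = refl
  sum-heap (suc h) v a f = cong₂ _+_
    (cong₂ _+_ (at l (toℕ-fromℕ< _)) (trans (sum-heap h _ _ f) (cong (λ j → heapSum h (suc j) (extend f)) (toℕ-fromℕ< _))))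
    (cong₂ _+_ (at r (toℕ-fromℕ< _)) (trans (sum-heap h _ _ f) (cong (λ j → heapSum h (suc j) (extend f)) (toℕ-fromℕ< _))))
    where
    l = eˡ (fork v a)
    r = eʳ (fork v a)
    at : ∀ e {j} → toℕ e ≡ j → f e ≡ extend f j
    at e refl = sym (extend-toℕ f e)

  whole : Tree k zero
  whole = heap k zero root-height

  -- The heap numbering runs through the edges level by level, so the tree contains each edge
  -- exactly once.
  sum-whole : ∀ f → sumₜ whole f ≡ sum f
  sum-whole f = trans (sum-heap k zero root-height f)
    (trans (heapSum≡range k (extend f)) (sym (sum≡range-extend f)))

  -- Six times the transition probabilities of the random walk along an edge,
  -- upwards and downwards.
  up down : Edge → ℕ
  up e   = if does (2 ^ k ≤? suc (suc (toℕ e))) then 6 else 2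
  down e = if does (toℕ e <? 2) then 3 else 2

  -- Six times the mass that one step of the walk moves along `e`, in both directions, when each
  -- vertex `v` carries mass `x v`.
  flow : (Vertex → ℕ) → Edge → ℕ
  flow x e = up e * x (src (T k) e) + down e * x (tgt (T k) e)

  private
    -- The shares, as functions of the height, that a vertex other than the root sends to its parent
    -- and to its children; they add up to 6.
    up-at down-at : ℕ → ℕ
    up-at zero      = 6
    up-at (suc _)   = 2
    down-at zero    = 0
    down-at (suc _) = 4

    up≡ : ∀ h e → AtHeight h (suc (toℕ e)) → up e ≡ up-at h
    up≡ zero e a = cong (λ b → if b then 6 else 2)
      (dec-true (2 ^ k ≤? suc (suc (toℕ e))) (≤-trans (a .lower) (≤-reflexive (*-identityʳ _))))
    up≡ (suc h) e a = cong (λ b → if b then 6 else 2)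
      (dec-false (2 ^ k ≤? suc (suc (toℕ e))) (<⇒≱ below))
      where
      below : suc (suc (toℕ e)) < 2 ^ k
      below = *-cancelˡ-≤ 2 (≤-trans (≤-trans (≤-reflexive (*-comm 2 _))
        (*-monoʳ-≤ (suc (suc (suc (toℕ e)))) (m≤m*n 2 (2 ^ h) {{m^n≢0 2 h}}))) (a .upper))

    down≡2 : ∀ e {i} → i ≢ 0 → toℕ e ≡ 2 * i ⊎ toℕ e ≡ suc (2 * i) → down e ≡ 2
    down≡2 e {i} i≢0 eq =
      cong (λ b → if b then 3 else 2) (dec-false (toℕ e <? 2) (≤⇒≯ (large eq)))
      where
      large : toℕ e ≡ 2 * i ⊎ toℕ e ≡ suc (2 * i) → 2 ≤ toℕ e
      large (inj₁ q) = ≤-trans (*-monoʳ-≤ 2 (n≢0⇒n>0 i≢0)) (≤-reflexive (sym q))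
      large (inj₂ q) = ≤-trans (*-monoʳ-≤ 2 (n≢0⇒n>0 i≢0)) (≤-trans (n≤1+n _) (≤-reflexive (sym q)))

    balance : ∀ h d y v s → 6 * (y + s) + d * v ≡ (up-at h * y + d * v) + (6 * s + down-at h * y)
    balance zero    = solve-∀
    balance (suc _) = solve-∀

    -- The flow through a planted tree: an inner vertex of the subtree sends out
    -- 6, of which its edge upwards carries up-at and its edges downwards down-at.
    flow-planted : ∀ h e (t : Tree h (src (T k) e)) d (x : Vertex → ℕ) {v} → AtHeight h (suc (toℕ e)) →
                   tgt (T k) e ≡ v → down e ≡ d →
                   6 * sumₜ t (x ∘ src (T k)) + down-at h * x (src (T k) e) ≡ sumₜ t (flow x) →
                   6 * (x (src (T k) e) + sumₜ t (x ∘ src (T k))) + d * x v ≡ flow x e + sumₜ t (flow x)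
    flow-planted h e t d x a refl refl eq = trans (balance h (down e) (x (src (T k) e)) (x (tgt (T k) e)) _)
      (cong₂ _+_ (cong (λ u → u * x (src (T k) e) + down e * x (tgt (T k) e)) (sym (up≡ h e a))) eq)

    flow-fork : ∀ a b d v p q → 6 * a + d * v ≡ p → 6 * b + d * v ≡ q → 6 * (a + b) + (d + d) * v ≡ p + q
    flow-fork a b d v p q refl refl = shuffle a b d v
      where
      shuffle : ∀ a b d v → 6 * (a + b) + (d + d) * v ≡ 6 * a + d * v + (6 * b + d * v)
      shuffle = solve-∀

    -- All vertices strictly below `v` spend their full 6 on edges of the tree, whereas `v` spends
    -- only its downward share there.
    flow-heap : ∀ h v a x → toℕ v ≢ 0 →
                6 * sumₜ (heap h v a) (x ∘ src (T k)) + down-at h * x v ≡ sumₜ (heap h v a) (flow x)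
    flow-heap zero    v a x v≢0 = refl
    flow-heap (suc h) v a x v≢0 = flow-fork (planted l tˡ) (planted r tʳ) 2 (x v) _ _
      (flow-planted h l tˡ 2 x (heightˡ v a) (tgtˡ (fork v a)) (down≡2 l v≢0 (inj₁ (toℕ-fromℕ< _)))
        (flow-heap h _ (heightˡ v a) x λ ()))
      (flow-planted h r tʳ 2 x (heightʳ v a) (tgtʳ (fork v a)) (down≡2 r v≢0 (inj₂ (toℕ-fromℕ< _)))
        (flow-heap h _ (heightʳ v a) x λ ()))
      where
      l = eˡ (fork v a)
      r = eʳ (fork v a)
      tˡ = heap h _ (heightˡ v a)
      tʳ = heap h _ (heightʳ v a)
      planted : ∀ e → Tree h (src (T k) e) → ℕ
      planted e t = x (src (T k) e) + sumₜ t (x ∘ src (T k))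

    flow-root : ∀ h a x → 6 * sumₜ (heap (suc h) zero a) (x ∘ src (T k)) + 6 * x zero
                          ≡ sumₜ (heap (suc h) zero a) (flow x)
    flow-root h a x = flow-fork (planted l tˡ) (planted r tʳ) 3 (x zero) _ _
      (flow-planted h l tˡ 3 x (heightˡ zero a) (tgtˡ (fork zero a)) (down≡3 l (toℕ-fromℕ< _))
        (flow-heap h _ (heightˡ zero a) x λ ()))
      (flow-planted h r tʳ 3 x (heightʳ zero a) (tgtʳ (fork zero a)) (down≡3' r (toℕ-fromℕ< _))
        (flow-heap h _ (heightʳ zero a) x λ ()))
      where
      l = eˡ (fork zero a)
      r = eʳ (fork zero a)
      tˡ = heap h _ (heightˡ zero a)
      tʳ = heap h _ (heightʳ zero a)
      planted : ∀ e → Tree h (src (T k) e) → ℕ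
      planted e t = x (src (T k) e) + sumₜ t (x ∘ src (T k))
      down≡3 : ∀ e → toℕ e ≡ 0 → down e ≡ 3
      down≡3 e eq rewrite eq = refl
      down≡3' : ∀ e → toℕ e ≡ 1 → down e ≡ 3
      down≡3' e eq rewrite eq = refl

  -- The transition probabilities out of each vertex sum to 1; `1 ≤ k` gives the root edges along
  -- which to send its mass.
  flow-conservation : 1 ≤ k → ∀ x → 6 * sum x ≡ sum (flow x)
  flow-conservation 1≤k x = trans (trans (*-distribˡ-+ 6 (x zero) _) (trans (+-comm (6 * x zero) _)
    (cong (λ s → 6 * s + 6 * x zero) (sym (sum-whole (x ∘ src (T k)))))))
    (trans (at-root k 1≤k root-height) (sum-whole (flow x)))
    where
    at-root : ∀ h → 1 ≤ h → (a : AtHeight h 0) → 6 * sumₜ (heap h zero a) (x ∘ src (T k)) + 6 * x zero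
                            ≡ sumₜ (heap h zero a) (flow x)
    at-root (suc h) _ a = flow-root h a x

  2≤up : ∀ e → 2 ≤ up e
  2≤up e with does (2 ^ k ≤? suc (suc (toℕ e)))
  ... | true  = s≤s (s≤s z≤n)
  ... | false = ≤-refl

  2≤down : ∀ e → 2 ≤ down e
  2≤down e with does (toℕ e <? 2)
  ... | true  = s≤s (s≤s z≤n)
  ... | false = ≤-refl

  up+down≤12 : ∀ e → up e + down e ≤ 12
  up+down≤12 e with does (2 ^ k ≤? suc (suc (toℕ e))) | does (toℕ e <? 2)
  ... | true  | true  = m≤m+n 9 3
  ... | true  | false = m≤m+n 8 4
  ... | false | true  = m≤m+n 5 7
  ... | false | false = m≤m+n 4 8

-- Passing between rationals and naturals.

module Rationals where
  open import Data.Integer using (ℤ; +_; -[1+_])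
  import Data.Integer as ℤ
  import Data.Integer.Properties as ℤₚ
  import Data.Nat as ℕ
  import Data.Nat.Properties as ℕₚ
  import Data.Rational as ℚ
  open ℚ using (_+_; _*_; _/_; ↥_; ↧ₙ_; mkℚ; toℚᵘ; Positive; NonNegative)
  open import Data.Rational.Properties
  open import Data.Rational.Unnormalised using (mkℚᵘ; *≡*; *≤*) renaming (_≃_ to _≃ᵘ_)
  import Data.Rational.Unnormalised.Properties as ℚᵘ

  toℚᵘ-ℕtoℚ : ∀ a → toℚᵘ (ℕtoℚ a) ≃ᵘ mkℚᵘ (+ a) 0
  toℚᵘ-ℕtoℚ a = toℚᵘ-fromℚᵘ (mkℚᵘ (+ a) 0)

  ℕtoℚ-+ : ∀ a b → ℕtoℚ (a ℕ.+ b) ≡ ℕtoℚ a + ℕtoℚ b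
  ℕtoℚ-+ a b = toℚᵘ-injective (ℚᵘ.≃-trans (toℚᵘ-ℕtoℚ (a ℕ.+ b)) (ℚᵘ.≃-sym
    (ℚᵘ.≃-trans (toℚᵘ-homo-+ (ℕtoℚ a) (ℕtoℚ b)) (ℚᵘ.≃-trans (ℚᵘ.+-cong (toℚᵘ-ℕtoℚ a) (toℚᵘ-ℕtoℚ b))
      (*≡* (cong (ℤ._* + 1) (trans (cong₂ ℤ._+_ (ℤₚ.*-identityʳ (+ a)) (ℤₚ.*-identityʳ (+ b))) (sym (ℤₚ.pos-+ a b)))))))))

  ℕtoℚ-* : ∀ a b → ℕtoℚ (a ℕ.* b) ≡ ℕtoℚ a * ℕtoℚ b
  ℕtoℚ-* a b = toℚᵘ-injective (ℚᵘ.≃-trans (toℚᵘ-ℕtoℚ (a ℕ.* b)) (ℚᵘ.≃-sym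
    (ℚᵘ.≃-trans (toℚᵘ-homo-* (ℕtoℚ a) (ℕtoℚ b)) (ℚᵘ.≃-trans (ℚᵘ.*-cong (toℚᵘ-ℕtoℚ a) (toℚᵘ-ℕtoℚ b))
      (*≡* (cong (ℤ._* + 1) (sym (ℤₚ.pos-* a b))))))))

  ℕtoℚ-mono-≤ : ∀ {a b} → a ℕ.≤ b → ℕtoℚ a ℚ.≤ ℕtoℚ b
  ℕtoℚ-mono-≤ {a} {b} a≤b = toℚᵘ-cancel-≤ (ℚᵘ.≤-respˡ-≃ (ℚᵘ.≃-sym (toℚᵘ-ℕtoℚ a))
    (ℚᵘ.≤-respʳ-≃ (ℚᵘ.≃-sym (toℚᵘ-ℕtoℚ b)) (*≤* (ℤₚ.*-monoʳ-≤-nonNeg (+ 1) (ℤ.+≤+ a≤b)))))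

  ℕtoℚ-cancel-≤ : ∀ {a b} → ℕtoℚ a ℚ.≤ ℕtoℚ b → a ℕ.≤ b
  ℕtoℚ-cancel-≤ {a} {b} le with ℚᵘ.≤-respˡ-≃ (toℚᵘ-ℕtoℚ a) (ℚᵘ.≤-respʳ-≃ (toℚᵘ-ℕtoℚ b) (toℚᵘ-mono-≤ le))
  ... | *≤* q = ℤₚ.drop‿+≤+ (ℤₚ.*-cancelʳ-≤-pos (+ a) (+ b) (+ 1) q)

  /-*-cancel : ∀ a b .{{_ : NonZero b}} → (+ a / b) * ℕtoℚ b ≡ ℕtoℚ a
  /-*-cancel a b@(ℕ.suc b-1) = toℚᵘ-injective (ℚᵘ.≃-trans (toℚᵘ-homo-* (+ a / b) (ℕtoℚ b))
    (ℚᵘ.≃-trans (ℚᵘ.*-cong (toℚᵘ-fromℚᵘ (mkℚᵘ (+ a) b-1)) (toℚᵘ-ℕtoℚ b))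
      (ℚᵘ.≃-trans (*≡* (trans (ℤₚ.*-identityʳ _) (cong ((+ a) ℤ.*_) (cong +_ (sym (ℕₚ.*-identityʳ b))))))
        (ℚᵘ.≃-sym (toℚᵘ-ℕtoℚ a)))))

  ℕtoℚ-positive : ∀ {a} .{{_ : NonZero a}} → Positive (ℕtoℚ a)
  ℕtoℚ-positive {ℕ.suc a} = normalize-pos (ℕ.suc a) 1

  ℕtoℚ-nonNegative : ∀ {a} → NonNegative (ℕtoℚ a)
  ℕtoℚ-nonNegative {a} = normalize-nonNeg a 1

  scale : ∀ c b k → c * ℕtoℚ b ≡ ℕtoℚ 1 → (c * ℕtoℚ k) * ℕtoℚ b ≡ ℕtoℚ k
  scale c b k eq = trans (*-assoc c (ℕtoℚ k) (ℕtoℚ b)) (trans (cong (c *_) (*-comm (ℕtoℚ k) (ℕtoℚ b)))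
    (trans (sym (*-assoc c (ℕtoℚ b) (ℕtoℚ k))) (trans (cong (_* ℕtoℚ k) eq) (*-identityˡ (ℕtoℚ k)))))

  powℚ-* : ∀ x y q → powℚ (x * y) q ≡ powℚ x q * powℚ y q
  powℚ-* x y ℕ.zero    = refl
  powℚ-* x y (ℕ.suc q) = trans (cong (x * y *_) (powℚ-* x y q)) (swap x y (powℚ x q) (powℚ y q))
    where
    swap : ∀ a b c d → (a * b) * (c * d) ≡ (a * c) * (b * d)
    swap a b c d = trans (*-assoc a b (c * d)) (trans (cong (a *_) (trans (sym (*-assoc b c d))
      (trans (cong (_* d) (*-comm b c)) (*-assoc c b d)))) (sym (*-assoc a c (b * d))))

  powℚ-ℕtoℚ : ∀ a q → powℚ (ℕtoℚ a) q ≡ ℕtoℚ (a ℕ.^ q)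
  powℚ-ℕtoℚ a ℕ.zero    = refl
  powℚ-ℕtoℚ a (ℕ.suc q) = trans (cong (ℕtoℚ a *_) (powℚ-ℕtoℚ a q)) (sym (ℕtoℚ-* a (a ℕ.^ q)))

  module _ {x c M} .{{_ : NonZero M}} (x*M≡c : x * ℕtoℚ M ≡ ℕtoℚ c) (A y q : ℕ) where
    private
      clearˡ : ℕtoℚ A * powℚ x q * ℕtoℚ (M ℕ.^ q) ≡ ℕtoℚ (A ℕ.* c ℕ.^ q)
      clearˡ = trans (*-assoc (ℕtoℚ A) _ _) (trans (cong (ℕtoℚ A *_) (trans (cong (powℚ x q *_) (sym (powℚ-ℕtoℚ M q)))
        (trans (sym (powℚ-* x (ℕtoℚ M) q)) (trans (cong (λ z → powℚ z q) x*M≡c) (powℚ-ℕtoℚ c q))))) (sym (ℕtoℚ-* A _)))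

      clearʳ : powℚ (ℕtoℚ y) q * ℕtoℚ (M ℕ.^ q) ≡ ℕtoℚ ((y ℕ.* M) ℕ.^ q)
      clearʳ = trans (cong₂ _*_ (powℚ-ℕtoℚ y q) refl) (trans (sym (ℕtoℚ-* (y ℕ.^ q) (M ℕ.^ q)))
        (cong ℕtoℚ (sym (Powers.^-distribʳ-* y M q))))

    -- Since `x` is c / M, multiplying by M^q clears all denominators.
    pow-≤⁻ : ℕtoℚ A * powℚ x q ℚ.≤ powℚ (ℕtoℚ y) q → A ℕ.* c ℕ.^ q ℕ.≤ (y ℕ.* M) ℕ.^ q
    pow-≤⁻ le = ℕtoℚ-cancel-≤ (subst₂ ℚ._≤_ clearˡ clearʳ
      (*-monoʳ-≤-nonNeg (ℕtoℚ (M ℕ.^ q)) {{ℕtoℚ-nonNegative {M ℕ.^ q}}} le))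

    pow-≤⁺ : A ℕ.* c ℕ.^ q ℕ.≤ (y ℕ.* M) ℕ.^ q → ℕtoℚ A * powℚ x q ℚ.≤ powℚ (ℕtoℚ y) q
    pow-≤⁺ le = *-cancelʳ-≤-pos (ℕtoℚ (M ℕ.^ q)) {{ℕtoℚ-positive {M ℕ.^ q} {{ℕₚ.m^n≢0 M q}}}}
      (subst₂ ℚ._≤_ (sym clearˡ) (sym clearʳ) (ℕtoℚ-mono-≤ le))

  -- `PowMulLe` branches on the sign of the reduced numerator; for e = R / b this selects the
  -- nonnegative branch and relates its exponents to `R` and `b`.
  fraction : ∀ e R b .{{_ : NonZero b}} → e * ℕtoℚ b ≡ ℕtoℚ R →
             ∃ λ p → ↥ e ≡ + p × p ℕ.* b ≡ R ℕ.* ↧ₙ e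
  fraction e@(mkℚ n d-1 _) R b@(ℕ.suc _) eq = numerator n cross
    where
    cross : n ℤ.* + b ≡ + (R ℕ.* ℕ.suc d-1)
    cross with ℚᵘ.≃-trans (ℚᵘ.≃-trans (ℚᵘ.*-cong (ℚᵘ.≃-refl {toℚᵘ e}) (ℚᵘ.≃-sym (toℚᵘ-ℕtoℚ b)))
                 (ℚᵘ.≃-sym (toℚᵘ-homo-* e (ℕtoℚ b))))
                 (ℚᵘ.≃-trans (ℚᵘ.≃-reflexive (cong toℚᵘ eq)) (toℚᵘ-ℕtoℚ R))
    ... | *≡* q = trans (sym (ℤₚ.*-identityʳ _)) (trans q
      (trans (cong (λ d → + R ℤ.* + d) (ℕₚ.*-identityʳ (ℕ.suc d-1))) (sym (ℤₚ.pos-* R (ℕ.suc d-1)))))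
    numerator : ∀ n → n ℤ.* + b ≡ + (R ℕ.* ℕ.suc d-1) → ∃ λ p → n ≡ + p × p ℕ.* b ≡ R ℕ.* ℕ.suc d-1
    numerator (+ p)    eq = p , refl , ℤₚ.+-injective (trans (ℤₚ.pos-* p b) eq)
    numerator -[1+ p ] ()

-- The threshold weighting.

module Weighting (k : ℕ) (1≤k : 1 ≤ k) where
  open import Data.Integer using (+_)
  import Data.Rational as ℚ
  import Data.Rational.Properties as ℚₚ
  open import Data.Nat using (_+_; _*_)
  open import Data.Nat.Properties
  open import Data.Vec.Properties using ([]=⇒lookup; lookup⇒[]=; lookup-replicate)
  open Sums
  open Rationals
  open Heap k
  open Subgraphs (T k)

  θ : Edge → ℚ.ℚ
  θ e = + (up e + down e) ℚ./ 6

  outflow : Subset (nE (T k)) → Edge → ℕ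
  outflow F e = if e ∈ᵇ F then 0 else flow (λ v → 𝟙 (v ∈ᵇ Vtx (T k) F)) e

  private
    N : ℕ
    N = nV (T k)

    weight : Subset (nE (T k)) → Edge → ℕ
    weight F e = if e ∈ᵇ F then up e + down e else 0

    sumθ*6 : ∀ F → sumθ (T k) θ F ℚ.* ℕtoℚ 6 ≡ ℕtoℚ (sum (weight F))
    sumθ*6 F = go id
      where
      partial : ∀ {m} → (Fin m → Edge) → ℚ.ℚ
      partial f = foldr (λ e acc → if e ∈ᵇ F then θ e ℚ.+ acc else acc) ℚ.0ℚ (Data.List.tabulate f)
      go : ∀ {m} (f : Fin m → Edge) → partial f ℚ.* ℕtoℚ 6 ≡ ℕtoℚ (sum (weight F ∘ f))
      go {zero}  f = ℚₚ.*-zeroˡ (ℕtoℚ 6)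
      go {suc m} f = add (f zero ∈ᵇ F) (up (f zero) + down (f zero)) (sum (weight F ∘ f ∘ suc)) (θ (f zero)) (partial (f ∘ suc))
                         (/-*-cancel (up (f zero) + down (f zero)) 6) (go (f ∘ suc))
        where
        add : ∀ i a b x y → x ℚ.* ℕtoℚ 6 ≡ ℕtoℚ a → y ℚ.* ℕtoℚ 6 ≡ ℕtoℚ b →
              (if i then x ℚ.+ y else y) ℚ.* ℕtoℚ 6 ≡ ℕtoℚ ((if i then a else 0) + b)
        add true  a b x y p q = trans (ℚₚ.*-distribʳ-+ (ℕtoℚ 6) x y) (trans (cong₂ ℚ._+_ p q) (sym (ℕtoℚ-+ a b)))
        add false a b x y p q = q

    split-flow : ∀ F e → flow (λ v → 𝟙 (v ∈ᵇ Vtx (T k) F)) e ≡ weight F e + outflow F e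
    split-flow F e with e ∈ᵇ F in eq
    ... | false = refl
    ... | true
      rewrite []=⇒lookup (∈Vtx⁺ {F} (lookup⇒[]= e F eq) (inj₁ refl))
            | []=⇒lookup (∈Vtx⁺ {F} (lookup⇒[]= e F eq) (inj₂ refl))
            | *-identityʳ (up e) | *-identityʳ (down e) = sym (+-identityʳ _)

    6*card : ∀ F → 6 * card (Vtx (T k) F) ≡ sum (weight F) + sum (outflow F)
    6*card F = trans (cong (6 *_) (card≡sum (Vtx (T k) F)))
      (trans (flow-conservation 1≤k (λ v → 𝟙 (v ∈ᵇ Vtx (T k) F))) (trans (sum-cong-≗ {nE (T k)} (split-flow F)) (∑-distrib-+ (weight F) (outflow F))))

    difference : ∀ C S R D → C ℚ.* ℕtoℚ 6 ≡ ℕtoℚ S ℚ.+ ℕtoℚ R → D ℚ.* ℕtoℚ 6 ≡ ℕtoℚ S →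
                 (C ℚ.- D) ℚ.* ℕtoℚ 6 ≡ ℕtoℚ R
    difference C S R D eqC eqD = begin
      (C ℚ.- D) ℚ.* ℕtoℚ 6                    ≡⟨ ℚₚ.*-distribʳ-+ (ℕtoℚ 6) C (ℚ.- D) ⟩
      C ℚ.* ℕtoℚ 6 ℚ.+ (ℚ.- D) ℚ.* ℕtoℚ 6     ≡⟨ cong₂ ℚ._+_ eqC (trans (sym (ℚₚ.neg-distribˡ-* D (ℕtoℚ 6))) (cong ℚ.-_ eqD)) ⟩
      (ℕtoℚ S ℚ.+ ℕtoℚ R) ℚ.- ℕtoℚ S          ≡⟨ cong (ℚ._- ℕtoℚ S) (ℚₚ.+-comm (ℕtoℚ S) (ℕtoℚ R)) ⟩
      (ℕtoℚ R ℚ.+ ℕtoℚ S) ℚ.- ℕtoℚ S          ≡⟨ ℚₚ.+-assoc (ℕtoℚ R) (ℕtoℚ S) _ ⟩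
      ℕtoℚ R ℚ.+ (ℕtoℚ S ℚ.- ℕtoℚ S)          ≡⟨ cong (ℕtoℚ R ℚ.+_) (ℚₚ.+-inverseʳ (ℕtoℚ S)) ⟩
      ℕtoℚ R ℚ.+ ℚ.0ℚ                         ≡⟨ ℚₚ.+-identityʳ (ℕtoℚ R) ⟩
      ℕtoℚ R                                  ∎
      where open ≡-Reasoning

    nonNegative : ∀ x R → x ℚ.* ℕtoℚ 6 ≡ ℕtoℚ R → ℚ.0ℚ ℚ.≤ x
    nonNegative x R eq = ℚₚ.*-cancelʳ-≤-pos (ℕtoℚ 6) {{ℕtoℚ-positive {6}}} (subst₂ ℚ._≤_ (sym (ℚₚ.*-zeroˡ (ℕtoℚ 6))) (sym eq) (ℕtoℚ-mono-≤ {0} {R} z≤n))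

    times6 : ∀ a b → 6 * a ≡ b → ℕtoℚ a ℚ.* ℕtoℚ 6 ≡ ℕtoℚ b
    times6 a b eq = trans (sym (ℕtoℚ-* a 6)) (cong ℕtoℚ (trans (*-comm a 6) eq))

  -- The vertices of `F` send out 6 |V(F)| in total. An edge of `F` has both ends in V(F) and
  -- carries 6 θ of it; the rest leaves along other edges.
  Δ*6 : ∀ F → Δ (T k) θ F ℚ.* ℕtoℚ 6 ≡ ℕtoℚ (sum (outflow F))
  Δ*6 F = difference (ℕtoℚ (card (Vtx (T k) F))) (sum (weight F)) (sum (outflow F)) (sumθ (T k) θ F)
    (trans (times6 (card (Vtx (T k) F)) (sum (weight F) + sum (outflow F)) (6*card F))
           (ℕtoℚ-+ (sum (weight F)) (sum (outflow F))))
    (sumθ*6 F)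

  -- Every transition probability is at least 1/3, that is, 2 out of 6.
  2*boundary≤outflow : ∀ F → 2 * sum (boundary F) ≤ sum (outflow F)
  2*boundary≤outflow F = ≤-trans (≤-reflexive (*-distribˡ-sum 2 (boundary F))) (sum-mono pointwise)
    where
    pointwise : ∀ e → 2 * boundary F e ≤ outflow F e
    pointwise e with e ∈ᵇ F
    ... | true  = z≤n
    ... | false with src (T k) e ∈ᵇ Vtx (T k) F | tgt (T k) e ∈ᵇ Vtx (T k) F
    ...   | true  | _     = m≤n⇒m≤n+o _ (≤-trans (2≤up e) (≤-reflexive (sym (*-identityʳ (up e)))))
    ...   | false | true  = m≤n⇒m≤o+n (up e * 0) (≤-trans (2≤down e) (≤-reflexive (sym (*-identityʳ (down e)))))
    ...   | false | false = z≤n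

  threshold : ThresholdWeighting (T k) θ
  threshold = (λ e → nonNegative (θ e) (up e + down e) (/-*-cancel (up e + down e) 6) , θ≤2 e)
            , (λ F → nonNegative (Δ (T k) θ F) (sum (outflow F)) (Δ*6 F))
            , zero-weight
    where
    θ≤2 : ∀ e → θ e ℚ.≤ ℕtoℚ 2
    θ≤2 e = ℚₚ.*-cancelʳ-≤-pos (ℕtoℚ 6) {{ℕtoℚ-positive {6}}} (subst₂ ℚ._≤_ (sym (/-*-cancel (up e + down e) 6)) (ℕtoℚ-* 2 6)
      (ℕtoℚ-mono-≤ (up+down≤12 e)))
    -- With unit mass on every vertex, each edge carries its whole weight and nothing is left over.
    all-flow : 6 * N ≡ sum (weight full)
    all-flow = trans (cong (6 *_) (sym (trans (sum-const N 1) (*-identityʳ N))))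
      (trans (flow-conservation 1≤k (λ _ → 1)) (sum-cong-≗ {nE (T k)} λ e →
        trans (cong₂ _+_ (*-identityʳ (up e)) (*-identityʳ (down e)))
              (cong (λ b → if b then up e + down e else 0) (sym (lookup-replicate e true)))))
    zero-weight : ΔG (T k) θ ≡ ℚ.0ℚ
    zero-weight = ℚₚ.≤-antisym
      (ℚₚ.*-cancelʳ-≤-pos (ℕtoℚ 6) {{ℕtoℚ-positive {6}}} (ℚₚ.≤-reflexive (trans eq (sym (ℚₚ.*-zeroˡ (ℕtoℚ 6))))))
      (nonNegative (ΔG (T k) θ) 0 eq)
      where
      eq : ΔG (T k) θ ℚ.* ℕtoℚ 6 ≡ ℕtoℚ 0
      eq = difference (ℕtoℚ N) (sum (weight full)) 0 (sumθ (T k) θ full)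
        (trans (times6 N (sum (weight full)) all-flow) (sym (ℚₚ.+-identityʳ (ℕtoℚ (sum (weight full)))))) (sumθ*6 full)

-- From the given definitions of pathsets and χ to the working ones.

module Conversion (k : ℕ) (1≤k : 1 ≤ k) (n : ℕ) .{{_ : NonZero n}} where
  open import Data.Integer using (+_)
  import Data.Rational as ℚ
  import Data.Rational.Properties as ℚₚ
  open import Data.Nat using (_+_; _*_; _^_; _⊔_)
  open import Data.Nat.Properties
  open import Data.Nat.Tactic.RingSolver using (solve-∀)
  open import Data.Bool.Properties using (T-≡)
  open import Data.Fin.Subset using (_∈_; _∉_)
  open import Data.Fin.Subset.Properties using (p─q⊆p; x∈p∩q⁻; _∈?_)
  open import Data.List using (map)
  open import Data.List.Membership.Propositional using (lose) renaming (_∈_ to _∈ₗ_)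
  open import Data.List.Membership.Propositional.Properties using (∈-allFin; ∈-map⁺; ∈-concatMap⁺)
  open import Data.List.Relation.Unary.Any.Properties using (any⁺)
  open import Data.Vec.Properties using ([]=⇒lookup; lookup⇒[]=)
  open import Function.Bundles using (Equivalence)
  open Equivalence
  open Powers
  open Sums
  open Rationals
  open Weighting k 1≤k
  open Subgraphs (T k)
  open Assignments n
  open Pathsets (T k) θ n
  open Complexity (T k) n 36 108 refl

  private
    instance
      n^N≢0 : NonZero (n ^ N)
      n^N≢0 = m^n≢0 n N

    filterCount-allVecs : ∀ j (P : Vec (Fin n) j → Bool) → filterCount P (allVecs j) ≡ ∣ P ∣
    filterCount-allVecs zero    P = refl
    filterCount-allVecs (suc j) P =
      trans (filterCount-concatMap P (λ i → map (i ∷_) (allVecs j)) id)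
        (sum-cong-≗ {n} λ i → trans (filterCount-map P (i ∷_) (allVecs j)) (filterCount-allVecs j (P ∘ (i ∷_))))

  count≡ : ∀ P → count P ≡ ∣ P ∣
  count≡ = filterCount-allVecs N

  μ*n^N : ∀ P → μ P ℚ.* ℕtoℚ (n ^ N) ≡ ℕtoℚ ∣ P ∣
  μ*n^N P = trans (/-*-cancel (count P) (n ^ N)) (cong ℕtoℚ (count≡ P))

  private
    ∈-allVecs : ∀ {j} (x : Vec (Fin n) j) → x ∈ₗ allVecs j
    ∈-allVecs []      = here refl
    ∈-allVecs (i ∷ x) = ∈-concatMap⁺ _ (lose (∈-allFin i) (∈-map⁺ (i ∷_) (∈-allVecs x)))

    all-tabulate : ∀ {m} {A : Set} (p : A → Bool) (f : Fin m → A) → (∀ i → p (f i) ≡ true) →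
                   all p (Data.List.tabulate f) ≡ true
    all-tabulate {zero}  p f h = refl
    all-tabulate {suc m} p f h = ∧⁺ (h zero) (all-tabulate p (f ∘ suc) (h ∘ suc))

    agree⁺ : ∀ U x y → (∀ v → v ∈ U → lookup x v ≡ lookup y v) → agree U x y ≡ true
    agree⁺ U x y h = all-tabulate _ id λ v → by-cases v
      where
      by-cases : ∀ v → (not (v ∈ᵇ U) ∨ eqᵇ (lookup x v) (lookup y v)) ≡ true
      by-cases v with v ∈? U
      ... | yes v∈ = ∨⁺ (inj₂ (eqᵇ⁺ (h v v∈)))
      ... | no v∉  = ∨⁺ (inj₁ (not-∈⁺ v∉))

    ∉-─ : ∀ {m} {x : Fin m} (p q : Subset m) → x ∈ p ─ q → x ∉ q
    ∉-─ (true ∷ p)  (true ∷ q)  () Data.Vec.here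
    ∉-─ (_ ∷ p)     (_ ∷ q)     (Data.Vec.there x∈) (Data.Vec.there x∈q) = ∉-─ p q x∈ x∈q

    -- The witness is `mix U z w` itself. This carries the density bound for `restrict` over to
    -- `P ∘ mix U z`.
    mix⊆restrict : ∀ V U P z w → P (mix U z w) ≡ true → restrict V U P z w ≡ true
    mix⊆restrict V U P z w Px = T-≡ .to (any⁺ (λ y → P y ∧ agree (V ─ U) y w ∧ agree (V ∩ U) y z) (lose (∈-allVecs (mix U z w)) (T-≡ .from
      (∧⁺ Px (∧⁺ (agree⁺ (V ─ U) (mix U z w) w λ v v∈ → trans (lookup-mix U z w v)
                    (cong (λ b → if b then lookup z v else lookup w v) (∉⇒false (∉-─ V U v∈))))
                 (agree⁺ (V ∩ U) (mix U z w) z λ v v∈ → trans (lookup-mix U z w v)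
                    (cong (λ b → if b then lookup z v else lookup w v) ([]=⇒lookup (proj₂ (x∈p∩q⁻ V U v∈))))))))))
      where
      ∉⇒false : ∀ {m} {v : Fin m} {U} → v ∉ U → v ∈ᵇ U ≡ false
      ∉⇒false {v = v} {U} v∉ with lookup U v in eq
      ... | true  = ⊥-elim (v∉ (lookup⇒[]= v U eq))
      ... | false = refl

    powMulLe⁻ : ∀ e R x c y → e ℚ.* ℕtoℚ 6 ≡ ℕtoℚ R → x ℚ.* ℕtoℚ (n ^ N) ≡ ℕtoℚ c →
                PowMulLe n e x (ℕtoℚ y) →
                ∃ λ p → ∃ λ q → NonZero q × p * 6 ≡ R * q × n ^ p * c ^ q ≤ (y * n ^ N) ^ q
    powMulLe⁻ e R x c y eq x≡ le with fraction e R 6 eq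
    ... | p , num , pq = p , ℚ.↧ₙ e , _ , pq ,
      pow-≤⁻ {x} {c} {n ^ N} x≡ (n ^ p) y (ℚ.↧ₙ e) (subst (λ i → powMulLeAux n i (ℚ.↧ₙ e) x (ℕtoℚ y)) num le)

  -- Δ ≥ δ / 3, both sides being multiplied by the denominator of Δ.
  pathset : ∀ F S (𝒜 : Rel (Vtx (T k) F ─ S)) → Pathset F S 𝒜 → IsPathset F S (proj₁ 𝒜)
  pathset F S (P , det) ps = record
    { depends = λ x y eq → det x y (agree⁺ _ x y λ v v∈ → eq v (p─q⊆p (Vtx (T k) F) S v∈))
    ; density = density
    }
    where
    cube : ∀ d a q p M .{{_ : NonZero q}} → d * q ≤ p * 3 → n ^ p * a ^ q ≤ M ^ q → n ^ d * a ^ 3 ≤ M ^ 3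
    cube d a q p M dq≤ le = ^-cancelˡ-≤ q (begin
      (n ^ d * a ^ 3) ^ q          ≡⟨ ^-distribʳ-* (n ^ d) (a ^ 3) q ⟩
      (n ^ d) ^ q * (a ^ 3) ^ q    ≡⟨ cong₂ _*_ (^-*-assoc n d q) (trans (^-*-assoc a 3 q) (trans (cong (a ^_) (*-comm 3 q)) (sym (^-*-assoc a q 3)))) ⟩
      n ^ (d * q) * (a ^ q) ^ 3    ≤⟨ *-monoˡ-≤ ((a ^ q) ^ 3) (^-monoʳ-≤ n dq≤) ⟩
      n ^ (p * 3) * (a ^ q) ^ 3    ≡⟨ cong (_* (a ^ q) ^ 3) (^-*-assoc n p 3) ⟨
      (n ^ p) ^ 3 * (a ^ q) ^ 3    ≡⟨ ^-distribʳ-* (n ^ p) (a ^ q) 3 ⟨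
      (n ^ p * a ^ q) ^ 3          ≤⟨ ^-monoˡ-≤ 3 le ⟩
      (M ^ q) ^ 3                  ≡⟨ trans (^-*-assoc M q 3) (trans (cong (M ^_) (*-comm q 3)) (sym (^-*-assoc M 3 q))) ⟩
      (M ^ 3) ^ q                  ∎)
      where open ≤-Reasoning
    third : ∀ d R p q → 2 * d ≤ R → p * 6 ≡ R * q → d * q ≤ p * 3
    third d R p q 2d≤R pq = *-cancelˡ-≤ 2 (begin
      2 * (d * q)  ≡⟨ *-assoc 2 d q ⟨
      2 * d * q    ≤⟨ *-monoˡ-≤ q 2d≤R ⟩
      R * q        ≡⟨ pq ⟨
      p * 6        ≡⟨ double p ⟩
      2 * (p * 3)  ∎)
      where
      open ≤-Reasoning
      double : ∀ p → p * 6 ≡ 2 * (p * 3)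
      double = solve-∀
    density : ∀ U → S ⊆ U → ∀ z → n ^ δ (_⊖_ (T k) F U) * ∣ P ∘ mix U z ∣ ^ 3 ≤ (n ^ N) ^ 3
    density U S⊆U z = conclude (powMulLe⁻ (Δ (T k) θ F') (sum (outflow F')) (μ R) ∣ R ∣ 1 (Δ*6 F') (μ*n^N R) (ps U S⊆U z))
      where
      F' : Subset (nE (T k))
      F' = _⊖_ (T k) F U
      R : Relation
      R = restrict (Vtx (T k) F ─ S) U P z
      conclude : (∃ λ p → ∃ λ q → NonZero q × p * 6 ≡ sum (outflow F') * q × n ^ p * ∣ R ∣ ^ q ≤ (1 * n ^ N) ^ q) →
                 n ^ δ F' * ∣ P ∘ mix U z ∣ ^ 3 ≤ (n ^ N) ^ 3
      conclude (p , q , q≢0 , pq , le) =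
        cube (δ F') ∣ P ∘ mix U z ∣ q p (n ^ N) {{q≢0}} (third (δ F') (sum (outflow F')) p q (2*boundary≤outflow F') pq)
          (≤-trans (*-monoʳ-≤ (n ^ p) (^-monoˡ-≤ q (∣∣-mono {P = P ∘ mix U z} {P' = R} (mix⊆restrict (Vtx (T k) F ─ S) U P z))))
            (≤-trans le (≤-reflexive (cong (_^ q) (*-identityˡ (n ^ N))))))

  ⋃ : ∀ {X : Set} → (X → Relation) → List X → Relation
  ⋃ rel []       x = false
  ⋃ rel (t ∷ ts) x = rel t x ∨ ⋃ rel ts x

  ⋃⁺ : ∀ {X : Set} (rel : X → Relation) {ts x} → Any (λ t → rel t x ≡ true) ts → ⋃ rel ts x ≡ true
  ⋃⁺ rel (here p)  = ∨⁺ (inj₁ p)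
  ⋃⁺ rel (there q) = ∨⁺ (inj₂ (⋃⁺ rel q))

  Chi-⋃ : ∀ {X : Set} {A S} (rel : X → Relation) (w : X → ℕ) (f : X → ℕ → ℕ) → (∀ t acc → f t acc ≡ w t + acc) →
          (∀ t → Chi A S (rel t) (w t)) → ∀ ts → Chi A S (⋃ rel ts) (foldr f 0 ts)
  Chi-⋃ rel w f f≡ piece []       = none
  Chi-⋃ rel w f f≡ piece (t ∷ ts) rewrite f≡ t (foldr f 0 ts) = union (piece t) (Chi-⋃ rel w f f≡ piece ts)

  chi : ∀ A S (𝒜 : Rel (VA A ─ S)) m → ChiLe A S 𝒜 m → Chi A S (proj₁ 𝒜) m
  chi (leaf l) S 𝒜 m (fam , len≤ , ps , cover) = weak (leaves fam ps) (λ x Px → ⋃⁺ proj₁ (cover x Px)) len≤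
    where
    leaves : ∀ fam → All (Pathset ⟨ leaf {T k} l ⟩ S) fam → Chi (leaf l) S (⋃ proj₁ fam) (length fam)
    leaves []        []       = none
    leaves (ℬ ∷ fam) (p ∷ ps) = union (leaf (pathset ⟨ leaf {T k} l ⟩ S ℬ p)) (leaves fam ps)
  chi (node B C) S 𝒜 m (fam , cover , cost≤) =
    weak (Chi-⋃ (λ t → proj₁ (proj₁ t)) (λ (_ , _ , _ , b , c , _) → b ⊔ c) _ (λ _ _ → refl)
           (λ (𝒟 , ℬ , 𝒞 , b , c , p , _ , _ , β , γ , join) →
             node (pathset ⟨ node B C ⟩ S 𝒟 p) (chi B S ℬ b β) (chi C S 𝒞 c γ)
                  (λ x q → proj₁ (join x q)) (λ x q → proj₂ (join x q)))
           fam)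
      (λ x Px → ⋃⁺ (λ t → proj₁ (proj₁ t)) (cover x Px)) cost≤

-- The lower bound for `T k`.

module Conclusion (k : ℕ) (16≤k : 16 ≤ k) where
  open import Data.Integer using (+_)
  import Data.Rational as ℚ
  open import Data.Nat using (_+_; _*_; _^_; _∸_)
  open import Data.Nat.Properties
  open import Data.Nat.Tactic.RingSolver using (solve-∀)
  open import Data.Fin.Subset.Properties using (∈⊤; ∉⊥)
  open Powers
  open Rationals

  1≤k : 1 ≤ k
  1≤k = ≤-trans (s≤s z≤n) 16≤k

  open Weighting k 1≤k public using (θ; threshold)
  open Heap k
  open Trees (T k) src-injective
  open Subgraphs (T k)

  whole⊆ : ∀ F → F ≡ full → whole ⊆ₜ _⊖_ (T k) F ∅
  whole⊆ F refl {e} e∈ = ⊖-greatest F (_∈ₜ whole) (λ _ → ∈⊤)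
    -- No edge leads upwards from the root, because `src` is always a successor.
    (λ e∈ e∋x _ f∋x → Data.Sum.[ id , (λ ()) ]′ (incident whole (∈ₜ-ends e∈ e∋x) f∋x)) (λ _ _ → ∉⊥) e∈

  private
    -- In terms of exponents, p / q = k / (2 b) ≤ j / b. The square of the hypothesis, raised to the
    -- power `q`, yields the claim to the power `b + b`.
    rescale : ∀ n .{{_ : NonZero n}} j b .{{_ : NonZero (b + b)}} a y p q → k ≤ j + j → p * (b + b) ≡ k * q →
              n ^ j * a ^ b ≤ y ^ b → n ^ p * a ^ q ≤ y ^ q
    rescale n j b a y p q k≤ pq le = ^-cancelˡ-≤ (b + b) (begin
      (n ^ p * a ^ q) ^ (b + b)               ≡⟨ ^-distribʳ-* (n ^ p) (a ^ q) (b + b) ⟩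
      (n ^ p) ^ (b + b) * (a ^ q) ^ (b + b)   ≡⟨ cong₂ _*_ (trans (^-*-assoc n p (b + b)) (trans (cong (n ^_) pq) (sym (^-*-assoc n k q)))) (exchange a q (b + b)) ⟩
      (n ^ k) ^ q * (a ^ (b + b)) ^ q         ≡⟨ ^-distribʳ-* (n ^ k) (a ^ (b + b)) q ⟨
      (n ^ k * a ^ (b + b)) ^ q               ≤⟨ ^-monoˡ-≤ q (*-monoˡ-≤ (a ^ (b + b)) (^-monoʳ-≤ n k≤)) ⟩
      (n ^ (j + j) * a ^ (b + b)) ^ q         ≡⟨ cong (_^ q) (trans (cong₂ _*_ (^-distribˡ-+-* n j j) (^-distribˡ-+-* a b b)) (regroup (n ^ j) (a ^ b))) ⟩
      ((n ^ j * a ^ b) * (n ^ j * a ^ b)) ^ q ≤⟨ ^-monoˡ-≤ q (*-mono-≤ le le) ⟩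
      (y ^ b * y ^ b) ^ q                     ≡⟨ cong (_^ q) (^-distribˡ-+-* y b b) ⟨
      (y ^ (b + b)) ^ q                       ≡⟨ exchange y q (b + b) ⟨
      (y ^ q) ^ (b + b)                       ∎)
      where
      open ≤-Reasoning
      exchange : ∀ a q b → (a ^ q) ^ b ≡ (a ^ b) ^ q
      exchange a q b = trans (^-*-assoc a q b) (trans (cong (a ^_) (*-comm q b)) (sym (^-*-assoc a b q)))
      regroup : ∀ x y → x * x * (y * y) ≡ (x * y) * (x * y)
      regroup = solve-∀

    -- The source of 16 and 216: from k = 16 on, the loss of 8 is at most half of `k`, so (k - 8) /
    -- 108 is at least k / 216.
    k≤ : k ≤ (k ∸ 8) + (k ∸ 8)
    k≤ = begin
      k                  ≤⟨ m≤n+m∸n k 8 ⟩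
      8 + (k ∸ 8)        ≤⟨ +-monoˡ-≤ (k ∸ 8) (∸-monoˡ-≤ 8 16≤k) ⟩
      (k ∸ 8) + (k ∸ 8)  ∎
      where open ≤-Reasoning

  lower-bound : ∀ e → e ℚ.* ℕtoℚ 216 ≡ ℕtoℚ k →
                ∀ A → ⟨ A ⟩ ≡ full → ∀ n .{{_ : NonZero n}} (𝒜 : Pathsets.Rel (T k) θ n (VA A ─ ∅)) m →
                Pathsets.ChiLe (T k) θ n A ∅ 𝒜 m →
                PowMulLe n e (Pathsets.μ (T k) θ n (proj₁ 𝒜)) (ℕtoℚ m)
  lower-bound e e≡ A A≡full n 𝒜@(P , _) m χ≤m = conclude (fraction e k 216 e≡)
    where
    open Conversion k 1≤k n
    open Complexity (T k) n 36 108 refl using (bound; bound-mono; δ)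
    open Potential (T k) src-injective whole (λ f → ≤-reflexive (sum-whole f)) n 108 refl using (potential)
    open Assignments n using (∣_∣)
    open Pathsets (T k) θ n using (μ)
    M = n ^ nV (T k)
    counting : n ^ (k ∸ 8) * ∣ P ∣ ^ 108 ≤ (m * M) ^ 108
    counting = bound-mono (m≤m+n (k ∸ 8) (12 * δ (_⊖_ (T k) ⟨ A ⟩ ∅)))
                 (potential A ∅ whole here (whole⊆ ⟨ A ⟩ A≡full)) .bound (chi A ∅ 𝒜 m χ≤m)
    conclude : (∃ λ p → ℚ.↥ e ≡ + p × p * 216 ≡ k * ℚ.↧ₙ e) → PowMulLe n e (μ P) (ℕtoℚ m)
    conclude (p , num , pq) = subst (λ i → powMulLeAux n i (ℚ.↧ₙ e) (μ P) (ℕtoℚ m)) (sym num)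
      (pow-≤⁺ {μ P} {∣ P ∣} {M} {{m^n≢0 n (nV (T k))}} (μ*n^N P) (n ^ p) m (ℚ.↧ₙ e)
        (rescale n (k ∸ 8) 108 ∣ P ∣ (m * M) p (ℚ.↧ₙ e) k≤ pq counting))

open import Data.Integer using (+_)
open import Data.Rational using (ℚ; 0ℚ; _<_; _*_; _/_)
open import Data.Rational.Properties using (positive⁻¹; normalize-pos)

theorem1p7 : Σ ℚ λ c → (0ℚ < c) × Σ ℕ λ k₀ → ∀ (k : ℕ) → k₀ ≤ k →
    Σ (Fin (nE (T k)) → ℚ) λ θ →
    ThresholdWeighting (T k) θ ×
    (∀ (A : JoinTree (T k)) → ⟨ A ⟩ ≡ full →
    ∀ (n : ℕ) .{{_ : NonZero n}} → (𝒜 : Pathsets.Rel (T k) θ n (VA A ─ ∅)) →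
    ∀ (m : ℕ) → Pathsets.ChiLe (T k) θ n A ∅ 𝒜 m →
    PowMulLe n (c * ℕtoℚ k) (Pathsets.μ (T k) θ n (proj₁ 𝒜)) (ℕtoℚ m))
theorem1p7 = + 1 / 216 , positive⁻¹ (+ 1 / 216) {{normalize-pos 1 216}} , 16 , λ k 16≤k →
  Conclusion.θ k 16≤k , Conclusion.threshold k 16≤k ,
  Conclusion.lower-bound k 16≤k (+ 1 / 216 * ℕtoℚ k)
    (Rationals.scale (+ 1 / 216) 216 k (Rationals./-*-cancel 1 216))
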